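{- For a positive integer $n$, $$\sum_{k=1}^n \frac{1}{k}|\mathcal{T}_{n,k}| = \sum_{k=1}^n \frac{1}{k}|\mathcal{F}_{n,k}| = n^n.$$
   Context: $\mathcal{T}_n$ is the set of rooted labeled trees on vertex set $[0,n]=\{0,\dots,n\}$. For $T\in\mathcal{T}_n$, the maximal decreasing subtree $\mathrm{MD}(T)$ is the subtree induced by the root and all vertices $v$ such that labels strictly decrease along the path from the root to $v$. $\mathcal{T}_{n,k}$ is the set of $T\in\mathcal{T}_n$ whose $\mathrm{MD}(T)$ has exactly $k+1$ vertices. $[n]=\{1,\dots,n\}$, and $\mathcal{F}_{n,k}$ is the set of functions $f:[n]\to[n]$ whose image contains $\{1,\dots,k\}$. -}

module Defs where

open import Data.Nat using (ℕ; zero; suc; _<ᵇ_; _≡ᵇ_)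
open import Data.Bool using (Bool; true; false; _∧_; _∨_; not)
open import Data.Fin using (Fin; toℕ)
open import Data.Maybe using (Maybe; just; nothing)
open import Data.List using (List; []; _∷_; [_]; map; concatMap; allFin; length; filter)
import Data.Bool.ListAction as L
open import Data.Vec using (Vec; []; _∷_; lookup; toList)
open import Data.Integer using (+_)
open import Data.Rational using (ℚ; 0ℚ; _+_; _/_)
open import Relation.Nullary.Decidable using (Dec)
open import Data.Bool.Properties using (T?)

allVecs : {A : Set} → List A → (m : ℕ) → List (Vec A m)
allVecs xs zero    = [ [] ]
allVecs xs (suc m) = concatMap (λ x → map (x ∷_) (allVecs xs m)) xs

countB : {A : Set} → (A → Bool) → List A → ℕ
countB P xs = length (filter (λ x → T? (P x)) xs)

-- Rooted labeled trees on vertex set [0,n] = Fin (suc n), encoded by the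
-- parent map: par v = nothing iff v is the root, par v = just u iff u is
-- the parent of v.

ParentMap : ℕ → Set
ParentMap n = Vec (Maybe (Fin (suc n))) (suc n)

reachesRoot : {n : ℕ} → ParentMap n → ℕ → Fin (suc n) → Bool
reachesRoot p zero     v = false
reachesRoot p (suc f)  v with lookup p v
... | nothing = true
... | just u  = reachesRoot p f u

isRoot : {n : ℕ} → ParentMap n → Fin (suc n) → Bool
isRoot p v with lookup p v
... | nothing = true
... | just _  = false

isRootedTree : {n : ℕ} → ParentMap n → Bool
isRootedTree {n} p =
  (countB (isRoot p) (allFin (suc n)) ≡ᵇ 1) ∧
  L.all (reachesRoot p (suc n)) (allFin (suc n))

trees : (n : ℕ) → List (ParentMap n)
trees n = filter (λ p → T? (isRootedTree p))
                 (allVecs (nothing ∷ map just (allFin (suc n))) (suc n))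

inMD : {n : ℕ} → ParentMap n → ℕ → Fin (suc n) → Bool
inMD p zero    v = false
inMD p (suc f) v with lookup p v
... | nothing = true
... | just u  = (toℕ v <ᵇ toℕ u) ∧ inMD p f u

mdSize : {n : ℕ} → ParentMap n → ℕ
mdSize {n} p = countB (inMD p (suc n)) (allFin (suc n))

cardT : ℕ → ℕ → ℕ
cardT n k = countB (λ p → mdSize p ≡ᵇ suc k) (trees n)

-- Functions [n] → [n], encoded as Vec (Fin n) n; label i ∈ [n] is the
-- element of Fin n with toℕ = i - 1.

inImage : {n : ℕ} → Vec (Fin n) n → Fin n → Bool
inImage f j = L.any (λ x → toℕ x ≡ᵇ toℕ j) (toList f)

imageContains : {n : ℕ} → ℕ → Vec (Fin n) n → Bool
imageContains {n} k f = L.all (λ j → not (toℕ j <ᵇ k) ∨ inImage f j) (allFin n)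

cardF : ℕ → ℕ → ℕ
cardF n k = countB (imageContains k) (allVecs (allFin n) n)

weightedSum : ℕ → (ℕ → ℕ) → ℚ
weightedSum zero    c = 0ℚ
weightedSum (suc j) c = weightedSum j c + (+ c (suc j)) / suc j

{-# OPTIONS --safe #-}
module Submission where

-- Fix D = MD(T) with k + 1 vertices and put r = n - k. There are k! decreasing trees on D, and the
-- other r vertices v form a forest hanging from D, where v may be attached to the w v elements of D
-- below it. Peeling off the children of D layer by layer, the number of such forests is
-- ∏ (r + w v) - ∑_v ∏_{u ≠ v} (r + w u). Summing over D turns the products into complete homogeneous
-- symmetric polynomials in r, r + 1, … ; the subtracted term is a sum over words with a marked
-- letter, i.e. over insertions of a letter, and the difference is h_r(r, …, r + k). The same
-- polynomial, times k!, counts the functions hitting {1, …, k}, sorted by the positions of first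
-- occurrences of 1, …, k.
--
-- Let c m k count the functions [m] → [n] hitting {1, …, k}. Then
-- c (m + 1) k / k = n c m k / k + (c m (k - 1) - c m k), which telescopes over k.

open import Defs
open import Data.Bool using (Bool; true; false; if_then_else_; _∧_; _∨_; not)
import Data.Bool.ListAction as L
open import Data.Bool.Properties using (T?; T-≡; ∧-zeroʳ; ∧-identityʳ; ∧-comm) renaming (_≟_ to _≟ᵇ_)
open import Data.Fin using (Fin; zero; suc; toℕ)
open import Data.Fin.Properties using (toℕ<n; toℕ-injective)
import Data.Integer as ℤ
import Data.Integer.Properties as ℤ
import Data.Integer.Tactic.RingSolver as ℤSolver
open import Data.List using (List; []; _∷_; _++_; map; concatMap; allFin; tabulate; filter)
open import Data.List.Properties using (map-++; map-∘)
open import Data.Maybe using (Maybe; just; nothing; maybe)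
open import Data.Nat
  using (ℕ; zero; suc; pred; _+_; _*_; _∸_; _^_; _!; _≤_; _<_; _≡ᵇ_; _<ᵇ_; z≤n; s≤s; s≤s⁻¹; _≤?_; ≢-nonZero)
open import Data.Nat.ListAction using (sum)
open import Data.Nat.ListAction.Properties using (sum-++)
open import Data.Nat.Properties
open import Data.Nat.Tactic.RingSolver using (solve-∀)
open import Data.Product using (∃; _×_; _,_; proj₁; proj₂)
open import Data.Rational using (ℚ; 0ℚ; _/_; fromℚᵘ) renaming (_+_ to _+ℚ_; _*_ to _*ℚ_)
import Data.Rational.Properties as ℚ
open import Data.Rational.Unnormalised using (ℚᵘ; mkℚᵘ; *≡*) renaming (_+_ to _+ᵘ_; _*_ to _*ᵘ_)
import Data.Rational.Unnormalised.Properties as ℚᵘ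
open import Data.Sum using (_⊎_; inj₁; inj₂)
open import Data.Vec as Vec using (Vec; []; _∷_; lookup; toList)
open import Data.Vec.Properties using (≡-dec; lookup∘tabulate; tabulate∘lookup; tabulate-cong)
open import Function using (_∘_; id; Equivalence)
open import Relation.Binary.PropositionalEquality
open import Relation.Nullary using (Dec; yes; no; does; contradiction)
open import Relation.Nullary.Decidable using (dec-true)

open import Algebra.Properties.Semiring.Sum +-*-semiring as Fin∑
  using () renaming (sum to ∑)
open import Algebra.Properties.CommutativeMonoid.Sum *-1-commutativeMonoid as Fin∏
  using () renaming (sum to ∏)

-- The two cardinalities agree for each `k`, so the first equality of sums holds term by term. The
-- forest formula is the matrix-tree determinant: with x v = r + w v and J the all-ones matrix of
-- size r, det(diag x - J) = ∏ x - ∑_v ∏_{u ≠ v} x u. Determinants are avoided because the product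
-- and its derivative are both multilinear in the rows. Writing each row as "parent in the front"
-- plus "parent in the rest" splits all terms alike, until a layer turns out empty while vertices
-- remain. Then the row sum of each remaining vertex is the number of remaining vertices, and the
-- derivative equals the product, in accordance with the fact that nothing can be attached any more.
-- To stay in ℕ, subtracted terms are moved to the other side. The other obstacle is fuel: trees and
-- MD are defined by bounded recursion, whereas the count needs a separate condition on each parent.
-- Only reachability of `D` stays global.

private variable
  A : Set
  m n : ℕ

-- Finite sums and products

𝟙 : Bool → ℕ
𝟙 false = 0
𝟙 true  = 1

𝟙-∧ : ∀ a b → 𝟙 (a ∧ b) ≡ 𝟙 a * 𝟙 b
𝟙-∧ false b = refl
𝟙-∧ true  b = sym (+-identityʳ (𝟙 b))

∑L : List A → (A → ℕ) → ℕ
∑L xs f = sum (map f xs)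

∑L-cong : ∀ (xs : List A) {f g : A → ℕ} → (∀ x → f x ≡ g x) → ∑L xs f ≡ ∑L xs g
∑L-cong []       eq = refl
∑L-cong (x ∷ xs) eq = cong₂ _+_ (eq x) (∑L-cong xs eq)

∑L-++ : ∀ (xs ys : List A) (f : A → ℕ) → ∑L (xs ++ ys) f ≡ ∑L xs f + ∑L ys f
∑L-++ xs ys f = trans (cong sum (map-++ f xs ys)) (sum-++ (map f xs) (map f ys))

∑L-map : ∀ {B : Set} (h : A → B) (xs : List A) (f : B → ℕ) → ∑L (map h xs) f ≡ ∑L xs (f ∘ h)
∑L-map h xs f = cong sum (sym (map-∘ xs))

∑L-concatMap : ∀ {B : Set} (h : A → List B) (xs : List A) (f : B → ℕ) →
               ∑L (concatMap h xs) f ≡ ∑L xs (λ x → ∑L (h x) f)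
∑L-concatMap h []       f = refl
∑L-concatMap h (x ∷ xs) f =
  trans (∑L-++ (h x) (concatMap h xs) f) (cong (∑L (h x) f +_) (∑L-concatMap h xs f))

∑L-+ : ∀ (xs : List A) (f g : A → ℕ) → ∑L xs (λ x → f x + g x) ≡ ∑L xs f + ∑L xs g
∑L-+ []       f g = refl
∑L-+ (x ∷ xs) f g rewrite ∑L-+ xs f g = interchange (f x) (g x) _ _
  where
  interchange : ∀ a b c d → (a + b) + (c + d) ≡ (a + c) + (b + d)
  interchange = solve-∀

∑L-*ˡ : ∀ (xs : List A) c (f : A → ℕ) → ∑L xs (λ x → c * f x) ≡ c * ∑L xs f
∑L-*ˡ []       c f = sym (*-zeroʳ c)
∑L-*ˡ (x ∷ xs) c f rewrite ∑L-*ˡ xs c f = sym (*-distribˡ-+ c (f x) _)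

∑L-*ʳ : ∀ (xs : List A) c (f : A → ℕ) → ∑L xs (λ x → f x * c) ≡ ∑L xs f * c
∑L-*ʳ xs c f = trans (∑L-cong xs (λ x → *-comm (f x) c)) (trans (∑L-*ˡ xs c f) (*-comm c _))

∑L-0 : ∀ (xs : List A) → ∑L xs (λ _ → 0) ≡ 0
∑L-0 []       = refl
∑L-0 (x ∷ xs) = ∑L-0 xs

∑L-comm : ∀ {B : Set} (xs : List A) (ys : List B) (f : A → B → ℕ) →
          ∑L xs (λ x → ∑L ys (f x)) ≡ ∑L ys (λ y → ∑L xs (λ x → f x y))
∑L-comm []       ys f = sym (∑L-0 ys)
∑L-comm (x ∷ xs) ys f = trans (cong (∑L ys (f x) +_) (∑L-comm xs ys f)) (sym (∑L-+ ys (f x) _))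

∑L-tabulate : ∀ (h : Fin n → A) (f : A → ℕ) → ∑L (tabulate h) f ≡ ∑ (f ∘ h)
∑L-tabulate {n = zero}  h f = refl
∑L-tabulate {n = suc n} h f = cong (f (h zero) +_) (∑L-tabulate (h ∘ suc) f)

∑L-allVecs : ∀ (xs : List A) m (F : Vec A (suc m) → ℕ) →
             ∑L (allVecs xs (suc m)) F ≡ ∑L xs (λ x → ∑L (allVecs xs m) (λ v → F (x ∷ v)))
∑L-allVecs xs m F = trans (∑L-concatMap _ xs F) (∑L-cong xs (λ x → ∑L-map (x ∷_) (allVecs xs m) F))

countB-∑L : ∀ (P : A → Bool) xs → countB P xs ≡ ∑L xs (𝟙 ∘ P)
countB-∑L P []       = refl
countB-∑L P (x ∷ xs) with P x
... | true  = cong suc (countB-∑L P xs)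
... | false = countB-∑L P xs

∑L-filter : ∀ (P : A → Bool) (f : A → ℕ) xs →
            ∑L (filter (λ x → T? (P x)) xs) f ≡ ∑L xs (λ x → 𝟙 (P x) * f x)
∑L-filter P f []       = refl
∑L-filter P f (x ∷ xs) with P x
... | true  = cong₂ _+_ (sym (+-identityʳ (f x))) (∑L-filter P f xs)
... | false = ∑L-filter P f xs

-- The pair (∏ x , ∂∏ x d) is the product of the dual numbers x v + d v ε.
∂∏ : (Fin n → ℕ) → (Fin n → ℕ) → ℕ
∂∏ {zero}  x d = 0
∂∏ {suc n} x d = d zero * ∏ (x ∘ suc) + x zero * ∂∏ (x ∘ suc) (d ∘ suc)

∂∏-cong : ∀ {x x′ d d′ : Fin n → ℕ} → (∀ v → x v ≡ x′ v) → (∀ v → d v ≡ d′ v) → ∂∏ x d ≡ ∂∏ x′ d′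
∂∏-cong {n = zero}  ex ed = refl
∂∏-cong {n = suc n} ex ed =
  cong₂ _+_ (cong₂ _*_ (ed zero) (Fin∏.sum-cong-≗ (ex ∘ suc)))
            (cong₂ _*_ (ex zero) (∂∏-cong (ex ∘ suc) (ed ∘ suc)))

∂∏-0 : ∀ (x : Fin n → ℕ) {d} → (∀ v → d v ≡ 0) → ∂∏ x d ≡ 0
∂∏-0 {n = zero}  x d0 = refl
∂∏-0 {n = suc n} x d0 rewrite d0 zero | ∂∏-0 (x ∘ suc) (d0 ∘ suc) = *-zeroʳ (x zero)

-- Where `d` is nonzero, `x` takes the constant value r, so each term of the derivative is `d v`
-- times ∏ x / r. The factor r on the left avoids the division.
∂∏-homogeneous : ∀ r (x d : Fin n → ℕ) → (∀ v → d v * r ≡ d v * x v) → r * ∂∏ x d ≡ ∑ d * ∏ x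
∂∏-homogeneous {n = zero}  r x d eq = *-zeroʳ r
∂∏-homogeneous {n = suc n} r x d eq = begin
  r * (d₀ * P + x₀ * D)       ≡⟨ expand r d₀ P x₀ D ⟩
  d₀ * r * P + x₀ * (r * D)   ≡⟨ cong₂ (λ a b → a * P + x₀ * b) (eq zero) (∂∏-homogeneous r _ _ (eq ∘ suc)) ⟩
  d₀ * x₀ * P + x₀ * (s * P)  ≡⟨ collect d₀ x₀ P s ⟩
  (d₀ + s) * (x₀ * P)         ∎
  where
  open ≡-Reasoning
  d₀ = d zero
  x₀ = x zero
  P = ∏ (x ∘ suc)
  D = ∂∏ (x ∘ suc) (d ∘ suc)
  s = ∑ (d ∘ suc)
  expand : ∀ r d₀ P x₀ D → r * (d₀ * P + x₀ * D) ≡ d₀ * r * P + x₀ * (r * D)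
  expand = solve-∀
  collect : ∀ d₀ x₀ P s → d₀ * x₀ * P + x₀ * (s * P) ≡ (d₀ + s) * (x₀ * P)
  collect = solve-∀

∑-∏-distrib : ∀ (xs : List A) (g : Fin m → A → ℕ) →
              ∑L (allVecs xs m) (λ p → ∏ (λ v → g v (lookup p v))) ≡ ∏ (λ v → ∑L xs (g v))
∑-∏-distrib {m = zero}  xs g = refl
∑-∏-distrib {m = suc m} xs g = begin
  ∑L (allVecs xs (suc m)) (λ p → ∏ (λ v → g v (lookup p v)))
    ≡⟨ ∑L-allVecs xs m _ ⟩
  ∑L xs (λ x → ∑L (allVecs xs m) (λ p → g zero x * ∏ (λ v → g (suc v) (lookup p v))))
    ≡⟨ ∑L-cong xs (λ x → trans (∑L-*ˡ (allVecs xs m) (g zero x) _)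
                               (cong (g zero x *_) (∑-∏-distrib xs (g ∘ suc)))) ⟩
  ∑L xs (λ x → g zero x * ∏ (λ v → ∑L xs (g (suc v))))
    ≡⟨ ∑L-*ʳ xs _ (g zero) ⟩
  ∏ (λ v → ∑L xs (g v)) ∎
  where open ≡-Reasoning

-- The law `∑-∏-distrib` over the dual numbers, read off in the coefficient of ε.
∑-∂∏-distrib : ∀ (xs : List A) (g d : Fin m → A → ℕ) →
               ∑L (allVecs xs m) (λ p → ∂∏ (λ v → g v (lookup p v)) (λ v → d v (lookup p v)))
               ≡ ∂∏ (λ v → ∑L xs (g v)) (λ v → ∑L xs (d v))
∑-∂∏-distrib {m = zero}  xs g d = refl
∑-∂∏-distrib {m = suc m} xs g d = begin
  ∑L (allVecs xs (suc m)) (λ p → ∂∏ (λ v → g v (lookup p v)) (λ v → d v (lookup p v)))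
    ≡⟨ ∑L-allVecs xs m _ ⟩
  ∑L xs (λ x → ∑L (allVecs xs m) (λ p →
    d zero x * ∏ (λ v → g (suc v) (lookup p v)) +
    g zero x * ∂∏ (λ v → g (suc v) (lookup p v)) (λ v → d (suc v) (lookup p v))))
    ≡⟨ ∑L-cong xs (λ x → trans (∑L-+ (allVecs xs m) _ _) (cong₂ _+_
         (trans (∑L-*ˡ (allVecs xs m) (d zero x) _) (cong (d zero x *_) (∑-∏-distrib xs (g ∘ suc))))
         (trans (∑L-*ˡ (allVecs xs m) (g zero x) _)
                (cong (g zero x *_) (∑-∂∏-distrib xs (g ∘ suc) (d ∘ suc)))))) ⟩
  ∑L xs (λ x → d zero x * P + g zero x * D)
    ≡⟨ ∑L-+ xs _ _ ⟩
  ∑L xs (λ x → d zero x * P) + ∑L xs (λ x → g zero x * D)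
    ≡⟨ cong₂ _+_ (∑L-*ʳ xs P (d zero)) (∑L-*ʳ xs D (g zero)) ⟩
  ∂∏ (λ v → ∑L xs (g v)) (λ v → ∑L xs (d v)) ∎
  where
  open ≡-Reasoning
  P = ∏ (λ v → ∑L xs (g (suc v)))
  D = ∂∏ (λ v → ∑L xs (g (suc v))) (λ v → ∑L xs (d (suc v)))

∏-zero : ∀ (x : Fin n → ℕ) v → x v ≡ 0 → ∏ x ≡ 0
∏-zero x zero    eq rewrite eq = refl
∏-zero x (suc v) eq rewrite ∏-zero (x ∘ suc) v eq = *-zeroʳ (x zero)

zero-or-nonzero : ∀ (x : Fin n → ℕ) → (∃ λ v → x v ≡ 0) ⊎ (∀ v → x v ≢ 0)
zero-or-nonzero {n = zero}  x = inj₂ λ ()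
zero-or-nonzero {n = suc n} x with x zero ≟ 0 | zero-or-nonzero (x ∘ suc)
... | yes eq | _              = inj₁ (zero , eq)
... | no _   | inj₁ (v , eq)  = inj₁ (suc v , eq)
... | no neq | inj₂ all       = inj₂ λ { zero → neq ; (suc v) → all v }

-- Reachability in consecutive layers is comparable only for parent maps of nonzero weight; the
-- others contribute nothing to either side.
∏-*-cong : ∀ (x : Fin n → ℕ) {a b} → ((∀ v → x v ≢ 0) → a ≡ b) → ∏ x * a ≡ ∏ x * b
∏-*-cong x eq with zero-or-nonzero x
... | inj₁ (v , z) rewrite ∏-zero x v z = refl
... | inj₂ nz      = cong (∏ x *_) (eq nz)

𝟙-zero : ∀ b → 𝟙 b ≡ 0 → b ≡ false
𝟙-zero false _ = refl

∑-zero⁻ : ∀ (x : Fin n → ℕ) → ∑ x ≡ 0 → ∀ v → x v ≡ 0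
∑-zero⁻ x eq zero    = m+n≡0⇒m≡0 (x zero) eq
∑-zero⁻ x eq (suc v) = ∑-zero⁻ (x ∘ suc) (m+n≡0⇒n≡0 (x zero) eq) v

∑-zero⁺ : ∀ (x : Fin n → ℕ) → (∀ v → x v ≡ 0) → ∑ x ≡ 0
∑-zero⁺ {n = zero}  x eq = refl
∑-zero⁺ {n = suc n} x eq rewrite eq zero = ∑-zero⁺ (x ∘ suc) (eq ∘ suc)

∑-nonzero : ∀ (b : Fin n → Bool) → ∑ (𝟙 ∘ b) ≢ 0 → ∃ λ v → b v ≡ true
∑-nonzero {n = zero}  b nz = contradiction refl nz
∑-nonzero {n = suc n} b nz with b zero in eq
... | true  = zero , eq
... | false with ∑-nonzero (b ∘ suc) nz
...   | v , bv = suc v , bv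

-- Layers of a rooted forest

-- Only the parents of the vertices coloured rest are still to be counted: they lie in the front or
-- among the rest, and every chain of parents has to reach the front.
data Colour : Set where
  done front rest : Colour

isFront isRest : Colour → Bool
isFront front = true
isFront _     = false
isRest rest = true
isRest _    = false

advance : Colour → Bool → Colour
advance rest true  = front
advance rest false = rest
advance _    _     = done

bools : List Bool
bools = false ∷ true ∷ []

module _ {N : ℕ} where

  Parent : Set
  Parent = Maybe (Fin N)

  parents : List Parent
  parents = nothing ∷ map just (allFin N)

  inFront inRest : (Fin N → Colour) → Parent → Bool
  inFront c = maybe (isFront ∘ c) false
  inRest  c = maybe (isRest ∘ c) false

  #front #rest : (Fin N → Colour) → ℕ
  #front c = ∑ (𝟙 ∘ isFront ∘ c)
  #rest  c = ∑ (𝟙 ∘ isRest ∘ c)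

  reach : (Fin N → Colour) → Vec Parent N → ℕ → Fin N → Bool
  reach c p zero    v = false
  reach c p (suc f) v = maybe (λ u → isFront (c u) ∨ (isRest (c u) ∧ reach c p f u)) false (lookup p v)

  allReach : (Fin N → Colour) → Vec Parent N → ℕ → ℕ
  allReach c p f = ∏ (λ v → 𝟙 (not (isRest (c v)) ∨ reach c p f v))

  ∑L-parents : ∀ (g : Parent → ℕ) → ∑L parents g ≡ g nothing + ∑ (g ∘ just)
  ∑L-parents g = cong (g nothing +_)
    (trans (∑L-map just (allFin N) g) (∑L-tabulate id (g ∘ just)))

  ∑-inRest : ∀ c → ∑L parents (𝟙 ∘ inRest c) ≡ #rest c
  ∑-inRest c = ∑L-parents (𝟙 ∘ inRest c)

  reach-noFront : ∀ c → (∀ v → isFront (c v) ≡ false) → ∀ p f v → reach c p f v ≡ false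
  reach-noFront c nf p zero    v = refl
  reach-noFront c nf p (suc f) v with lookup p v
  ... | nothing = refl
  ... | just u rewrite nf u | reach-noFront c nf p f u with isRest (c u)
  ...   | true  = refl
  ...   | false = refl

  allReach-noFront : ∀ c p f v → isRest (c v) ≡ true → (∀ v → isFront (c v) ≡ false) → allReach c p f ≡ 0
  allReach-noFront c p f v rv nf =
    ∏-zero _ v (cong 𝟙 (trans (cong (λ b → not b ∨ reach c p f v) rv) (reach-noFront c nf p f v)))

  advanced : (Fin N → Colour) → Vec Bool N → Fin N → Colour
  advanced c S v = advance (c v) (lookup S v)

  module Layer (c : Fin N → Colour) (φ G : Fin N → Parent → ℕ) where

    -- The Boolean says whether v joins the next front. Outside the rest, `true` has weight 0, so
    -- that `S` may run through all Boolean vectors, and `G` keeps the constraints on the parents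
    -- there. The weight `φ` is general because the first layer carries a label condition and the
    -- later ones do not.
    split : Fin N → Bool → Parent → ℕ
    split v b x with c v | b
    ... | rest  | true  = φ v x
    ... | rest  | false = 𝟙 (inRest c x)
    ... | _     | true  = 0
    ... | _     | false = G v x

    split-sum : (∀ v → c v ≡ rest → ∀ x → G v x ≡ φ v x + 𝟙 (inRest c x)) →
                ∀ v x → ∑L bools (λ b → split v b x) ≡ G v x
    split-sum hG v x with c v in eq
    ... | done  = +-identityʳ _
    ... | front = +-identityʳ _
    ... | rest  = begin
      𝟙 (inRest c x) + (φ v x + 0)  ≡⟨ cong (𝟙 (inRest c x) +_) (+-identityʳ _) ⟩
      𝟙 (inRest c x) + φ v x        ≡⟨ +-comm (𝟙 (inRest c x)) _ ⟩
      φ v x + 𝟙 (inRest c x)        ≡⟨ sym (hG v eq x) ⟩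
      G v x                         ∎
      where open ≡-Reasoning

    δ-sum : ∀ v → ∑L bools (λ b → 𝟙 (isRest (advance (c v) b))) ≡ 𝟙 (isRest (c v))
    δ-sum v with c v
    ... | done  = refl
    ... | front = refl
    ... | rest  = refl

    module _ (φ⊂front : ∀ v x → φ v x ≢ 0 → inFront c x ≡ true)
             (S : Vec Bool N) (p : Vec Parent N)
             (pos : ∀ v → split v (lookup S v) (lookup p v) ≢ 0) where

      private c′ = advanced c S

      newFront-parent : ∀ v → c v ≡ rest → lookup S v ≡ true → inFront c (lookup p v) ≡ true
      newFront-parent v cv Sv with pos v
      ... | pv rewrite cv | Sv = φ⊂front v _ pv

      rest-parent : ∀ v → c v ≡ rest → lookup S v ≡ false → inRest c (lookup p v) ≡ true
      rest-parent v cv Sv with pos v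
      ... | pv rewrite cv | Sv with inRest c (lookup p v)
      ...   | true  = refl
      ...   | false = contradiction refl pv

      reach-newFront : ∀ f v → c v ≡ rest → lookup S v ≡ true → reach c p (suc f) v ≡ true
      reach-newFront f v cv Sv with lookup p v | newFront-parent v cv Sv
      ... | just u | fu rewrite fu = refl

      reach-rest : ∀ f v → c v ≡ rest → lookup S v ≡ false → reach c p (suc f) v ≡ reach c′ p f v
      reach-rest f v cv Sv with lookup p v in pv | rest-parent v cv Sv
      reach-rest zero v cv Sv | just u | ru with c u
      ... | rest = refl
      reach-rest (suc f) v cv Sv | just u | ru rewrite pv with c u in cu | lookup S u in Su
      ... | rest | true  = reach-newFront f u cu Su
      ... | rest | false = reach-rest f u cu Su

      -- Nonzero weight puts the parents of the chosen vertices into the old front and those of the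
      -- other remaining vertices into the rest, so a chain meets the new front exactly one step
      -- before the old one.
      allReach-advance : ∀ f → allReach c p (suc f) ≡ allReach c′ p f
      allReach-advance f = Fin∏.sum-cong-≗ same
        where
        same : ∀ v → 𝟙 (not (isRest (c v)) ∨ reach c p (suc f) v)
                   ≡ 𝟙 (not (isRest (c′ v)) ∨ reach c′ p f v)
        same v with c v in cv | lookup S v in Sv
        ... | done  | _     = refl
        ... | front | _     = refl
        ... | rest  | true  = cong 𝟙 (reach-newFront f v cv Sv)
        ... | rest  | false = cong 𝟙 (reach-rest f v cv Sv)

  #advanced : ∀ (c : Fin N → Colour) S → #rest c ≡ #front (advanced c S) + #rest (advanced c S)
  #advanced c S = trans (Fin∑.sum-cong-≗ same)
    (Fin∑.∑-distrib-+ (𝟙 ∘ isFront ∘ advanced c S) (𝟙 ∘ isRest ∘ advanced c S))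
    where
    same : ∀ v → 𝟙 (isRest (c v)) ≡ 𝟙 (isFront (advanced c S v)) + 𝟙 (isRest (advanced c S v))
    same v with c v | lookup S v
    ... | done  | _     = refl
    ... | front | _     = refl
    ... | rest  | true  = refl
    ... | rest  | false = refl

  inRest-advanced : ∀ (c : Fin N → Colour) S x →
    𝟙 (inRest c x) ≡ 𝟙 (inFront (advanced c S) x) + 𝟙 (inRest (advanced c S) x)
  inRest-advanced c S nothing  = refl
  inRest-advanced c S (just u) with c u | lookup S u
  ... | done  | _     = refl
  ... | front | _     = refl
  ... | rest  | true  = refl
  ... | rest  | false = refl

  split-rest : ∀ (c : Fin N → Colour) (φ G : Fin N → Parent → ℕ) (S : Vec Bool N) v →
               advanced c S v ≡ rest → ∀ x → Layer.split c φ G v (lookup S v) x ≡ 𝟙 (inRest c x)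
  split-rest c φ G S v eq x with c v | lookup S v
  ... | rest | false = refl
  split-rest c φ G S v () x | done | _
  split-rest c φ G S v () x | front | _
  split-rest c φ G S v () x | rest | true

  isRest⇒≡ : ∀ k → isRest k ≡ true → k ≡ rest
  isRest⇒≡ rest _ = refl

  -- No vertex was chosen, so no chain can reach a front and the first sum is 0. Each remaining
  -- vertex has all r remaining vertices, itself included, as possible parents; hence
  -- `∂∏-homogeneous` gives r ∂∏ = r ∏.
  isolated-count : ∀ (c : Fin N → Colour) (φ G : Fin N → Parent → ℕ) (S : Vec Bool N) →
    #front (advanced c S) ≡ 0 → #rest (advanced c S) ≢ 0 → ∀ f →
    ∑L (allVecs parents N) (λ p →
      ∏ (λ v → Layer.split c φ G v (lookup S v) (lookup p v)) * allReach (advanced c S) p f)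
    + ∂∏ (λ v → ∑L parents (Layer.split c φ G v (lookup S v))) (λ v → 𝟙 (isRest (advanced c S v)))
    ≡ ∏ (λ v → ∑L parents (Layer.split c φ G v (lookup S v)))
  isolated-count c φ G S nf nr f with ∑-nonzero _ nr
  ... | v , rv = begin
    ∑L (allVecs parents N) (λ p → ∏ (λ v → split v (lookup S v) (lookup p v)) * allReach c′ p f) + ∂∏ V δ
      ≡⟨ cong (_+ ∂∏ V δ) (trans (∑L-cong (allVecs parents N) λ p →
           trans (cong (weight p *_) (allReach-noFront c′ p f v rv λ u → 𝟙-zero _ (∑-zero⁻ _ nf u)))
                 (*-zeroʳ (weight p)))
           (∑L-0 (allVecs parents N))) ⟩
    ∂∏ V δ
      ≡⟨ *-cancelˡ-≡ _ _ r {{≢-nonZero nr}} (∂∏-homogeneous r V δ homogeneous) ⟩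
    ∏ V ∎
    where
    open ≡-Reasoning
    open Layer c φ G using (split)
    c′ = advanced c S
    weight : Vec Parent N → ℕ
    weight p = ∏ (λ v → split v (lookup S v) (lookup p v))
    V δ : Fin N → ℕ
    V v = ∑L parents (split v (lookup S v))
    δ v = 𝟙 (isRest (c′ v))
    r = #rest c′
    homogeneous : ∀ v → δ v * r ≡ δ v * V v
    homogeneous v with isRest (c′ v) in eq
    ... | false = refl
    ... | true  = cong (1 *_) (sym (trans (∑L-cong parents (split-rest c φ G S v (isRest⇒≡ (c′ v) eq)))
                    (trans (∑-inRest c) (trans (#advanced c S) (cong (_+ r) nf)))))

  -- By induction on the number of layers: choosing the set S of vertices whose parent lies in the front
  -- exhibits each of the three terms as a sum over S. The ∂∏ term counts the
  -- parent maps in which some remaining vertex does not reach the front.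
  acyclic-count : ∀ f (c : Fin N → Colour) (φ G : Fin N → Parent → ℕ) →
    (∀ v x → φ v x ≢ 0 → inFront c x ≡ true) →
    (∀ v → c v ≡ rest → ∀ x → G v x ≡ φ v x + 𝟙 (inRest c x)) →
    #rest c ≤ f →
    ∑L (allVecs parents N) (λ p → ∏ (λ v → G v (lookup p v)) * allReach c p f)
    + ∂∏ (λ v → ∑L parents (G v)) (λ v → 𝟙 (isRest (c v)))
    ≡ ∏ (λ v → ∑L parents (G v))
  acyclic-count zero c φ G hφ hG r≤0 = begin
    ∑L (allVecs parents N) (λ p → ∏ (λ v → G v (lookup p v)) * allReach c p 0)
    + ∂∏ (λ v → ∑L parents (G v)) (λ v → 𝟙 (isRest (c v)))
      ≡⟨ cong₂ _+_ (∑L-cong (allVecs parents N) (λ p →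
                      trans (cong (∏ (λ v → G v (lookup p v)) *_) (trivial p)) (*-identityʳ _)))
                   (∂∏-0 _ no-rest) ⟩
    ∑L (allVecs parents N) (λ p → ∏ (λ v → G v (lookup p v))) + 0
      ≡⟨ +-identityʳ _ ⟩
    ∑L (allVecs parents N) (λ p → ∏ (λ v → G v (lookup p v)))
      ≡⟨ ∑-∏-distrib parents G ⟩
    ∏ (λ v → ∑L parents (G v)) ∎
    where
    open ≡-Reasoning
    no-rest : ∀ v → 𝟙 (isRest (c v)) ≡ 0
    no-rest = ∑-zero⁻ _ (n≤0⇒n≡0 r≤0)
    trivial : ∀ p → allReach c p 0 ≡ 1
    trivial p = trans (Fin∏.sum-cong-≗ λ v → cong (λ b → 𝟙 (not b ∨ false)) (𝟙-zero _ (no-rest v)))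
                      (Fin∏.sum-replicate-zero N)
  acyclic-count (suc f) c φ G hφ hG r≤f = begin
    ∑L ps (λ p → ∏ (λ v → G v (lookup p v)) * allReach c p (suc f)) + ∂∏ V δ
      ≡⟨ cong₂ _+_ count-split ∂-split ⟩
    ∑L Ss X + ∑L Ss (λ S → ∂∏ (V′ S) (δ′ S))
      ≡⟨ ∑L-+ Ss X _ ⟨
    ∑L Ss (λ S → X S + ∂∏ (V′ S) (δ′ S))
      ≡⟨ ∑L-cong Ss per-layer ⟩
    ∑L Ss (λ S → ∏ (V′ S))
      ≡⟨ trans (∑-∏-distrib bools (λ v b → ∑L parents (split v b))) (Fin∏.sum-cong-≗ V-split) ⟩
    ∏ V ∎
    where
    open ≡-Reasoning
    open Layer c φ G
    ps = allVecs parents N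
    Ss = allVecs bools N
    V δ : Fin N → ℕ
    V v = ∑L parents (G v)
    δ v = 𝟙 (isRest (c v))
    V′ δ′ : Vec Bool N → Fin N → ℕ
    V′ S v = ∑L parents (split v (lookup S v))
    δ′ S v = 𝟙 (isRest (advanced c S v))
    weight : Vec Bool N → Vec Parent N → ℕ
    weight S p = ∏ (λ v → split v (lookup S v) (lookup p v))
    X : Vec Bool N → ℕ
    X S = ∑L ps (λ p → weight S p * allReach (advanced c S) p f)

    V-split : ∀ v → ∑L bools (λ b → ∑L parents (split v b)) ≡ V v
    V-split v = trans (∑L-comm bools parents (split v)) (∑L-cong parents (split-sum hG v))

    ∂-split : ∂∏ V δ ≡ ∑L Ss (λ S → ∂∏ (V′ S) (δ′ S))
    ∂-split = sym (trans
      (∑-∂∏-distrib bools (λ v b → ∑L parents (split v b)) (λ v b → 𝟙 (isRest (advance (c v) b))))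
      (∂∏-cong V-split δ-sum))

    count-split : ∑L ps (λ p → ∏ (λ v → G v (lookup p v)) * allReach c p (suc f)) ≡ ∑L Ss X
    count-split = begin
      ∑L ps (λ p → ∏ (λ v → G v (lookup p v)) * allReach c p (suc f))
        ≡⟨ ∑L-cong ps (λ p → cong (_* allReach c p (suc f)) (sym (trans
             (∑-∏-distrib bools (λ v b → split v b (lookup p v)))
             (Fin∏.sum-cong-≗ λ v → split-sum hG v (lookup p v))))) ⟩
      ∑L ps (λ p → ∑L Ss (λ S → weight S p) * allReach c p (suc f))
        ≡⟨ ∑L-cong ps (λ p → sym (∑L-*ʳ Ss (allReach c p (suc f)) (λ S → weight S p))) ⟩
      ∑L ps (λ p → ∑L Ss (λ S → weight S p * allReach c p (suc f)))
        ≡⟨ ∑L-cong ps (λ p → ∑L-cong Ss (λ S →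
             ∏-*-cong (λ v → split v (lookup S v) (lookup p v)) (λ pos → allReach-advance hφ S p pos f))) ⟩
      ∑L ps (λ p → ∑L Ss (λ S → weight S p * allReach (advanced c S) p f))
        ≡⟨ ∑L-comm ps Ss _ ⟩
      ∑L Ss X ∎

    per-layer : ∀ S → X S + ∂∏ (V′ S) (δ′ S) ≡ ∏ (V′ S)
    -- A nonempty layer lowers `#rest` enough for the induction. If more than f vertices remain,
    -- then `#rest c ≤ suc f` forces the new front to be empty.
    per-layer S with #rest (advanced c S) ≤? f
    ... | yes r′≤f = acyclic-count f (advanced c S)
            (λ _ x → 𝟙 (inFront (advanced c S) x)) (λ v → split v (lookup S v))
            (λ v x nz → front-only x nz)
            (λ v cv x → trans (split-rest c φ G S v cv x) (inRest-advanced c S x))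
            r′≤f
      where
      front-only : ∀ x → 𝟙 (inFront (advanced c S) x) ≢ 0 → inFront (advanced c S) x ≡ true
      front-only x nz with inFront (advanced c S) x
      ... | true  = refl
      ... | false = contradiction refl nz
    ... | no r′≰f = isolated-count c φ G S front≡0 (λ r′≡0 → r′≰f (subst (_≤ f) (sym r′≡0) z≤n)) f
      where
      front≡0 : #front (advanced c S) ≡ 0
      front≡0 = n≤0⇒n≡0 (+-cancelʳ-≤ (suc f) _ 0
        (≤-trans (+-monoʳ-≤ (#front (advanced c S)) (≰⇒> r′≰f))
                 (≤-trans (≤-reflexive (sym (#advanced c S))) r≤f)))

-- Words and complete homogeneous symmetric polynomials

-- The complete homogeneous symmetric polynomial of degree m - i in r + j, …, r + j + i,
-- read off the words of length m with i marked letters.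
W : ℕ → ℕ → ℕ → ℕ → ℕ
W r zero    zero    j = 1
W r zero    (suc i) j = 0
W r (suc m) zero    j = (r + j) * W r m zero j
W r (suc m) (suc i) j = W r m i (suc j) + (r + j) * W r m (suc i) j

-- The definition splits off the smallest variable r + j; this splits off the greatest one, r + j +
-- i + 1. Both describe the same symmetric polynomial.
W-last : ∀ r m i j → W r (suc m) (suc i) j ≡ W r m i j + (r + suc (j + i)) * W r m (suc i) j
W-last r zero    zero    j rewrite *-zeroʳ (r + j) | *-zeroʳ (r + suc (j + 0)) = refl
W-last r zero    (suc i) j rewrite *-zeroʳ (r + j) | *-zeroʳ (r + suc (j + suc i)) = refl
W-last r (suc m) zero    j = trans
  (cong (λ a → (r + suc j) * W r m 0 (suc j) + (r + j) * a) (W-last r m zero j))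
  (identity r j (W r m 0 (suc j)) (W r m 0 j) (W r m 1 j))
  where
  identity : ∀ r j a b c → (r + suc j) * a + (r + j) * (b + (r + suc (j + 0)) * c)
                         ≡ (r + j) * b + (r + suc (j + 0)) * (a + (r + j) * c)
  identity = solve-∀
W-last r (suc m) (suc i) j = trans
  (cong₂ (λ a b → a + (r + j) * b) (W-last r m i (suc j)) (W-last r m (suc i) j))
  (identity r j i (W r m i (suc j)) (W r m (suc i) (suc j)) (W r m (suc i) j) (W r m (suc (suc i)) j))
  where
  identity : ∀ r j i a b c d →
    a + (r + suc (suc j + i)) * b + (r + j) * (c + (r + suc (j + suc i)) * d)
    ≡ a + (r + j) * c + (r + suc (j + suc i)) * (b + (r + j) * d)
  identity = solve-∀

-- Sums over the candidates `D` for the maximal decreasing subtree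

card : Vec Bool m → ℕ
card D = ∑ (𝟙 ∘ lookup D)

above below : Vec Bool m → Fin m → ℕ
above D v = ∑ (λ u → 𝟙 (lookup D u ∧ (toℕ v <ᵇ toℕ u)))
below D v = ∑ (λ u → 𝟙 (lookup D u ∧ (toℕ u <ᵇ toℕ v)))

-- The number of admissible parents of v when D is the maximal decreasing subtree, r vertices lie outside
-- D, and j elements of D have been split off below the labels of the vector. The indicator accounts
-- for the root, which is the greatest element of D.
choices : ℕ → ℕ → Vec Bool m → Fin m → ℕ
choices r j D v = if lookup D v then 𝟙 (above D v ≡ᵇ 0) + above D v else r + (j + below D v)

choices-true : ∀ r j (D : Vec Bool m) → choices r j (true ∷ D) zero ≡ 𝟙 (card D ≡ᵇ 0) + card D
choices-true r j D = cong (λ a → 𝟙 (a ≡ᵇ 0) + a) (Fin∑.sum-cong-≗ λ u → cong 𝟙 (∧-identityʳ (lookup D u)))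

choices-false : ∀ r j (D : Vec Bool m) → choices r j (false ∷ D) zero ≡ r + j
choices-false r j D = cong (r +_) (trans
  (cong (j +_) (∑-zero⁺ (λ u → 𝟙 (lookup D u ∧ false)) (λ u → cong 𝟙 (∧-zeroʳ (lookup D u)))))
  (+-identityʳ j))

choices-suc : ∀ r j b (D : Vec Bool m) v → choices r j (b ∷ D) (suc v) ≡ choices r (𝟙 b + j) D v
choices-suc r j b D v rewrite ∧-zeroʳ b | ∧-identityʳ b with lookup D v
... | true  = refl
... | false = cong (r +_) (trans (sym (+-assoc j (𝟙 b) _)) (cong (_+ below D v) (+-comm j (𝟙 b))))

∑-bools-suc : ∀ m (F : Vec Bool (suc m) → ℕ) →
  ∑L (allVecs bools (suc m)) F ≡
  ∑L (allVecs bools m) (F ∘ (false ∷_)) + ∑L (allVecs bools m) (F ∘ (true ∷_))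
∑-bools-suc m F = trans (∑L-allVecs bools m F)
  (cong (∑L (allVecs bools m) (F ∘ (false ∷_)) +_) (+-identityʳ _))

𝟙-≡ᵇ-* : ∀ a b (F : ℕ → ℕ) → 𝟙 (a ≡ᵇ b) * F a ≡ 𝟙 (a ≡ᵇ b) * F b
𝟙-≡ᵇ-* zero    zero    F = refl
𝟙-≡ᵇ-* zero    (suc b) F = refl
𝟙-≡ᵇ-* (suc a) zero    F = refl
𝟙-≡ᵇ-* (suc a) (suc b) F = 𝟙-≡ᵇ-* a b (F ∘ suc)

-- A new least element of `D` is the root if `D` was empty, and otherwise has i possible parents.
!-pred : ∀ i → (𝟙 (i ≡ᵇ 0) + i) * pred i ! ≡ i !
!-pred zero    = refl
!-pred (suc i) = refl

∑-first-absent : ∀ r i j (Y : Vec Bool m → ℕ) →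
  ∑L (allVecs bools m) (λ D → 𝟙 (card D ≡ᵇ i) * (choices r j (false ∷ D) zero * Y D))
  ≡ (r + j) * ∑L (allVecs bools m) (λ D → 𝟙 (card D ≡ᵇ i) * Y D)
∑-first-absent {m = m} r i j Y = trans
  (∑L-cong (allVecs bools m) λ D → trans
    (cong (λ a → 𝟙 (card D ≡ᵇ i) * (a * Y D)) (choices-false r j D))
    (swap (𝟙 (card D ≡ᵇ i)) (r + j) (Y D)))
  (∑L-*ˡ (allVecs bools m) (r + j) _)
  where
  swap : ∀ a b c → a * (b * c) ≡ b * (a * c)
  swap = solve-∀

∑-first-present : ∀ r i j (Y : Vec Bool m → ℕ) →
  ∑L (allVecs bools m) (λ D → 𝟙 (card D ≡ᵇ i) * (choices r j (true ∷ D) zero * Y D))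
  ≡ (𝟙 (i ≡ᵇ 0) + i) * ∑L (allVecs bools m) (λ D → 𝟙 (card D ≡ᵇ i) * Y D)
∑-first-present {m = m} r i j Y = trans
  (∑L-cong (allVecs bools m) λ D → trans
    (cong (λ a → 𝟙 (card D ≡ᵇ i) * (a * Y D)) (choices-true r j D)) (trans
    (𝟙-≡ᵇ-* (card D) i (λ a → (𝟙 (a ≡ᵇ 0) + a) * Y D))
    (swap (𝟙 (card D ≡ᵇ i)) (𝟙 (i ≡ᵇ 0) + i) (Y D))))
  (∑L-*ˡ (allVecs bools m) (𝟙 (i ≡ᵇ 0) + i) _)
  where
  swap : ∀ a b c → a * (b * c) ≡ b * (a * c)
  swap = solve-∀

-- By membership of the least label. If absent, it contributes r + j, an unmarked letter. If
-- present, it is a marked letter: its parent is any other element of `D`, and j grows by one for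
-- all labels above. The factors of a nonempty `D` multiply to (i - 1)!.
∑-∏-choices : ∀ r m i j →
  ∑L (allVecs bools m) (λ D → 𝟙 (card D ≡ᵇ i) * ∏ (choices r j D)) ≡ pred i ! * W r m i j

∑-∏-choices-tail : ∀ r m b i j →
  ∑L (allVecs bools m) (λ D → 𝟙 (card D ≡ᵇ i) * ∏ (choices r j (b ∷ D) ∘ suc)) ≡ pred i ! * W r m i (𝟙 b + j)
∑-∏-choices-tail r m b i j = trans
  (∑L-cong (allVecs bools m) λ D → cong (𝟙 (card D ≡ᵇ i) *_) (Fin∏.sum-cong-≗ (choices-suc r j b D)))
  (∑-∏-choices r m i (𝟙 b + j))

∑-∏-choices r zero    zero    j = refl
∑-∏-choices r zero    (suc i) j = sym (*-zeroʳ (i !))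
∑-∏-choices r (suc m) i j = begin
  ∑L (allVecs bools (suc m)) (λ D → 𝟙 (card D ≡ᵇ i) * ∏ (choices r j D))
    ≡⟨ ∑-bools-suc m _ ⟩
  term false i + ∑L (allVecs bools m) (λ D → 𝟙 (suc (card D) ≡ᵇ i) * ∏ (choices r j (true ∷ D)))
    ≡⟨ cong₂ _+_ absent (present i) ⟩
  (r + j) * (pred i ! * W r m i j) + marked i
    ≡⟨ collect i ⟩
  pred i ! * W r (suc m) i j ∎
  where
  open ≡-Reasoning
  term : Bool → ℕ → ℕ
  term b i = ∑L (allVecs bools m) (λ D → 𝟙 (card D ≡ᵇ i) * ∏ (choices r j (b ∷ D)))
  absent : term false i ≡ (r + j) * (pred i ! * W r m i j)
  absent = trans (∑-first-absent {m = m} r i j (λ D → ∏ (choices r j (false ∷ D) ∘ suc)))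
    (cong ((r + j) *_) (∑-∏-choices-tail r m false i j))
  marked : ℕ → ℕ
  marked zero    = 0
  marked (suc i) = (𝟙 (i ≡ᵇ 0) + i) * (pred i ! * W r m i (suc j))
  present : ∀ i → ∑L (allVecs bools m) (λ D → 𝟙 (suc (card D) ≡ᵇ i) * ∏ (choices r j (true ∷ D))) ≡ marked i
  present zero    = ∑L-0 (allVecs bools m)
  present (suc i) = trans (∑-first-present {m = m} r i j (λ D → ∏ (choices r j (true ∷ D) ∘ suc)))
    (cong ((𝟙 (i ≡ᵇ 0) + i) *_) (∑-∏-choices-tail r m true i j))
  identity : ∀ x f w f′ w′ t → t * f′ ≡ f → x * (f * w) + t * (f′ * w′) ≡ f * (w′ + x * w)
  identity x f w f′ w′ t eq = trans (cong (x * (f * w) +_) (sym (*-assoc t f′ w′)))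
    (trans (cong (λ a → x * (f * w) + a * w′) eq) (factor x f w w′))
    where
    factor : ∀ x f w w′ → x * (f * w) + f * w′ ≡ f * (w′ + x * w)
    factor = solve-∀
  collect : ∀ i → (r + j) * (pred i ! * W r m i j) + marked i ≡ pred i ! * W r (suc m) i j
  collect zero    = simplify (r + j) (W r m 0 j)
    where
    simplify : ∀ x w → x * (1 * w) + 0 ≡ 1 * (x * w)
    simplify = solve-∀
  collect (suc i) = identity (r + j) (i !) (W r m (suc i) j) (pred i !) (W r m i (suc j))
    (𝟙 (i ≡ᵇ 0) + i) (!-pred i)

absent? : Vec Bool m → Fin m → ℕ
absent? D v = 𝟙 (not (lookup D v))

-- The derivative marks a label outside `D` and drops its factor. Deleting that label leaves all
-- other factors unchanged, since they depend on `D` only, and it can be put back at m positions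
-- among the other m - 1 labels.
∑-∂∏-choices : ∀ r m i j →
  ∑L (allVecs bools m) (λ D → 𝟙 (card D ≡ᵇ i) * ∂∏ (choices r j D) (absent? D))
  ≡ pred i ! * (m * W r (pred m) i j)
∑-∂∏-choices-tail : ∀ r m b i j →
  ∑L (allVecs bools m) (λ D → 𝟙 (card D ≡ᵇ i) * ∂∏ (choices r j (b ∷ D) ∘ suc) (absent? D))
  ≡ pred i ! * (m * W r (pred m) i (𝟙 b + j))
∑-∂∏-choices-tail r m b i j = trans
  (∑L-cong (allVecs bools m) λ D → cong (𝟙 (card D ≡ᵇ i) *_) (∂∏-cong (choices-suc r j b D) (λ _ → refl)))
  (∑-∂∏-choices r m i (𝟙 b + j))

∑-∂∏-choices r zero    i j = trans (+-identityʳ _) (trans (*-zeroʳ (𝟙 (0 ≡ᵇ i))) (sym (*-zeroʳ (pred i !))))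
∑-∂∏-choices r (suc m) i j = begin
  ∑L (allVecs bools (suc m)) (λ D → 𝟙 (card D ≡ᵇ i) * ∂∏ (choices r j D) (absent? D))
    ≡⟨ ∑-bools-suc m _ ⟩
  ∑L (allVecs bools m) (λ D → 𝟙 (card D ≡ᵇ i) * ∂∏ (choices r j (false ∷ D)) (absent? (false ∷ D)))
  + ∑L (allVecs bools m) (λ D → 𝟙 (suc (card D) ≡ᵇ i) * ∂∏ (choices r j (true ∷ D)) (absent? (true ∷ D)))
    ≡⟨ cong₂ _+_ absent (present i) ⟩
  pred i ! * W r m i j + (r + j) * (pred i ! * (m * W r (pred m) i j)) + marked m i
    ≡⟨ collect m i ⟩
  pred i ! * (suc m * W r m i j) ∎
  where
  open ≡-Reasoning
  P D′ : Bool → Vec Bool m → ℕ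
  P  b D = ∏ (choices r j (b ∷ D) ∘ suc)
  D′ b D = ∂∏ (choices r j (b ∷ D) ∘ suc) (absent? D)
  distribute : ∀ a p x d → a * (1 * p + x * d) ≡ a * p + a * (x * d)
  distribute = solve-∀
  absent : ∑L (allVecs bools m) (λ D → 𝟙 (card D ≡ᵇ i) * ∂∏ (choices r j (false ∷ D)) (absent? (false ∷ D)))
         ≡ pred i ! * W r m i j + (r + j) * (pred i ! * (m * W r (pred m) i j))
  absent = trans
    (∑L-cong (allVecs bools m) λ D →
      distribute (𝟙 (card D ≡ᵇ i)) (P false D) (choices r j (false ∷ D) zero) (D′ false D)) (trans
    (∑L-+ (allVecs bools m) _ _)
    (cong₂ _+_ (∑-∏-choices-tail r m false i j)
      (trans (∑-first-absent r i j (D′ false)) (cong ((r + j) *_) (∑-∂∏-choices-tail r m false i j)))))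
  marked : ℕ → ℕ → ℕ
  marked m zero    = 0
  marked m (suc i) = (𝟙 (i ≡ᵇ 0) + i) * (pred i ! * (m * W r (pred m) i (suc j)))
  present : ∀ i →
    ∑L (allVecs bools m) (λ D → 𝟙 (suc (card D) ≡ᵇ i) * ∂∏ (choices r j (true ∷ D)) (absent? (true ∷ D)))
    ≡ marked m i
  present zero    = ∑L-0 (allVecs bools m)
  present (suc i) = trans (∑-first-present r i j (D′ true))
    (cong ((𝟙 (i ≡ᵇ 0) + i) *_) (∑-∂∏-choices-tail r m true i j))
  factor : ∀ f w x w₁ s t f′ w₂ → t * f′ ≡ f →
    f * w + x * (f * (s * w₁)) + t * (f′ * (s * w₂)) ≡ f * (w + s * (w₂ + x * w₁))
  factor f w x w₁ s t f′ w₂ eq = trans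
    (cong (f * w + x * (f * (s * w₁)) +_) (trans (sym (*-assoc t f′ _)) (cong (_* (s * w₂)) eq)))
    (collected f w x w₁ s w₂)
    where
    collected : ∀ f w x w₁ s w₂ → f * w + x * (f * (s * w₁)) + f * (s * w₂) ≡ f * (w + s * (w₂ + x * w₁))
    collected = solve-∀
  collect : ∀ m i → pred i ! * W r m i j + (r + j) * (pred i ! * (m * W r (pred m) i j)) + marked m i
                  ≡ pred i ! * (suc m * W r m i j)
  collect zero i = vanish i
    where
    vanish₁ : ∀ f w x → f * w + x * (f * 0) + 0 ≡ f * (w + 0)
    vanish₁ = solve-∀
    vanish₂ : ∀ f w x t f′ → f * w + x * (f * 0) + t * (f′ * 0) ≡ f * (w + 0)
    vanish₂ = solve-∀
    vanish : ∀ i → pred i ! * W r 0 i j + (r + j) * (pred i ! * 0) + marked 0 i ≡ pred i ! * (1 * W r 0 i j)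
    vanish zero    = vanish₁ 1 1 (r + j)
    vanish (suc i) = vanish₂ (i !) 0 (r + j) (𝟙 (i ≡ᵇ 0) + i) (pred i !)
  collect (suc m) zero = simplify (r + j) (W r m 0 j) (suc m)
    where
    simplify : ∀ x w s → 1 * (x * w) + x * (1 * (s * w)) + 0 ≡ 1 * (x * w + s * (x * w))
    simplify = solve-∀
  collect (suc m) (suc i) = factor (i !) (W r (suc m) (suc i) j) (r + j) (W r m (suc i) j) (suc m)
    (𝟙 (i ≡ᵇ 0) + i) (pred i !) (W r m i (suc j)) (!-pred i)

-- The maximal decreasing subtree

∧-true⁻ : ∀ a {b} → a ∧ b ≡ true → a ≡ true × b ≡ true
∧-true⁻ true eq = refl , eq

∧-true⁺ : ∀ {a b} → a ≡ true → b ≡ true → a ∧ b ≡ true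
∧-true⁺ refl eq = eq

true-⇔ : ∀ {a b} → (a ≡ true → b ≡ true) → (b ≡ true → a ≡ true) → a ≡ b
true-⇔ {false} {false} f g = refl
true-⇔ {false} {true}  f g = g refl
true-⇔ {true}  {b}     f g = sym (f refl)

<⇒<ᵇ≡true : ∀ {a b} → a < b → (a <ᵇ b) ≡ true
<⇒<ᵇ≡true a<b = Equivalence.to T-≡ (<⇒<ᵇ a<b)

<ᵇ≡true⇒< : ∀ a b → (a <ᵇ b) ≡ true → a < b
<ᵇ≡true⇒< a b eq = <ᵇ⇒< a b (Equivalence.from T-≡ eq)

≤⇒>ᵇ≡false : ∀ {a b} → a ≤ b → (b <ᵇ a) ≡ false
≤⇒>ᵇ≡false {a} {b} a≤b with b <ᵇ a in eq
... | false = refl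
... | true  = contradiction (<ᵇ≡true⇒< b a eq) (≤⇒≯ a≤b)

≡ᵇ≡true⇒≡ : ∀ a b → (a ≡ᵇ b) ≡ true → a ≡ b
≡ᵇ≡true⇒≡ a b eq = ≡ᵇ⇒≡ a b (Equivalence.from T-≡ eq)

allF : (Fin n → Bool) → Bool
allF {zero}  b = true
allF {suc n} b = b zero ∧ allF (b ∘ suc)

allF⁺ : ∀ {b : Fin n → Bool} → (∀ v → b v ≡ true) → allF b ≡ true
allF⁺ {n = zero}  eq = refl
allF⁺ {n = suc n} eq = ∧-true⁺ (eq zero) (allF⁺ (eq ∘ suc))

allF⁻ : ∀ (b : Fin n → Bool) → allF b ≡ true → ∀ v → b v ≡ true
allF⁻ b eq zero    = proj₁ (∧-true⁻ (b zero) eq)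
allF⁻ b eq (suc v) = allF⁻ (b ∘ suc) (proj₂ (∧-true⁻ (b zero) eq)) v

allF-cong : ∀ {a b : Fin n → Bool} → (∀ v → a v ≡ b v) → allF a ≡ allF b
allF-cong {n = zero}  eq = refl
allF-cong {n = suc n} eq = cong₂ _∧_ (eq zero) (allF-cong (eq ∘ suc))

∏-𝟙 : ∀ (b : Fin n → Bool) → ∏ (𝟙 ∘ b) ≡ 𝟙 (allF b)
∏-𝟙 {n = zero}  b = refl
∏-𝟙 {n = suc n} b = trans (cong (𝟙 (b zero) *_) (∏-𝟙 (b ∘ suc))) (sym (𝟙-∧ (b zero) _))

all-tabulate : ∀ (f : A → Bool) (h : Fin n → A) → L.all f (tabulate h) ≡ allF (f ∘ h)
all-tabulate {n = zero}  f h = refl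
all-tabulate {n = suc n} f h = cong (f (h zero) ∧_) (all-tabulate f (h ∘ suc))

∑-𝟙≤n : ∀ (b : Fin n → Bool) → ∑ (𝟙 ∘ b) ≤ n
∑-𝟙≤n {n = zero}  b = z≤n
∑-𝟙≤n {n = suc n} b with b zero
... | true  = s≤s (∑-𝟙≤n (b ∘ suc))
... | false = m≤n⇒m≤1+n (∑-𝟙≤n (b ∘ suc))

∑-𝟙-full : ∀ (b : Fin n → Bool) → n ≤ ∑ (𝟙 ∘ b) → ∀ v → b v ≡ true
∑-𝟙-full {n = suc n} b le v with b zero in eq | v
... | false | _     = contradiction (≤-trans le (∑-𝟙≤n (b ∘ suc))) 1+n≰n
... | true  | zero  = eq
... | true  | suc u = ∑-𝟙-full (b ∘ suc) (s≤s⁻¹ le) u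

∑-𝟙-compare : ∀ (a b : Fin n → Bool) → (∀ v → a v ≡ true → b v ≡ true) →
              (∀ v → b v ≡ a v) ⊎ ∑ (𝟙 ∘ a) < ∑ (𝟙 ∘ b)
∑-𝟙-compare {n = zero}  a b a⇒b = inj₁ λ ()
∑-𝟙-compare {n = suc n} a b a⇒b
  with a zero in a₀ | b zero in b₀ | ∑-𝟙-compare (a ∘ suc) (b ∘ suc) (a⇒b ∘ suc)
... | true  | false | _       = contradiction (trans (sym b₀) (a⇒b zero a₀)) λ ()
... | true  | true  | inj₁ eq = inj₁ λ { zero → trans b₀ (sym a₀) ; (suc v) → eq v }
... | true  | true  | inj₂ lt = inj₂ (s≤s lt)
... | false | true  | inj₁ eq = inj₂ (s≤s (≤-reflexive (sym (Fin∑.sum-cong-≗ (cong 𝟙 ∘ eq)))))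
... | false | true  | inj₂ lt = inj₂ (m≤n⇒m≤1+n lt)
... | false | false | inj₁ eq = inj₁ λ { zero → trans b₀ (sym a₀) ; (suc v) → eq v }
... | false | false | inj₂ lt = inj₂ lt

∑-𝟙≡1-unique : ∀ (b : Fin n → Bool) → ∑ (𝟙 ∘ b) ≡ 1 → ∀ v w → b v ≡ true → b w ≡ true → v ≡ w
∑-𝟙≡1-unique b eq zero    zero    bv bw = refl
∑-𝟙≡1-unique b eq zero    (suc w) bv bw rewrite bv =
  contradiction (trans (sym (cong 𝟙 bw)) (∑-zero⁻ (𝟙 ∘ b ∘ suc) (suc-injective eq) w)) λ ()
∑-𝟙≡1-unique b eq (suc v) zero    bv bw rewrite bw =
  contradiction (trans (sym (cong 𝟙 bv)) (∑-zero⁻ (𝟙 ∘ b ∘ suc) (suc-injective eq) v)) λ ()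
∑-𝟙≡1-unique b eq (suc v) (suc w) bv bw with b zero
... | false = cong suc (∑-𝟙≡1-unique (b ∘ suc) eq v w bv bw)
... | true  = contradiction (trans (sym (cong 𝟙 bv)) (∑-zero⁻ (𝟙 ∘ b ∘ suc) (suc-injective eq) v)) λ ()

infix 4 _≟ᵛ_
_≟ᵛ_ : (D X : Vec Bool m) → Dec (D ≡ X)
_≟ᵛ_ = ≡-dec _≟ᵇ_

∑-bools-δ : ∀ (X : Vec Bool m) (f : Vec Bool m → ℕ) →
            ∑L (allVecs bools m) (λ D → 𝟙 (does (D ≟ᵛ X)) * f D) ≡ f X
∑-bools-δ []          f = trans (+-identityʳ _) (+-identityʳ _)
∑-bools-δ {m = suc m} (false ∷ X) f = trans (∑-bools-suc m _)
  (trans (cong₂ _+_ (∑-bools-δ X (f ∘ (false ∷_))) (∑L-0 (allVecs bools m))) (+-identityʳ _))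
∑-bools-δ {m = suc m} (true ∷ X)  f = trans (∑-bools-suc m _)
  (cong₂ _+_ (∑L-0 (allVecs bools m)) (∑-bools-δ X (f ∘ (true ∷_))))

-- A root is forced to be an element of `D` with nothing above it, so uniqueness of the maximum
-- yields the single root of a tree.
∑-top : ∀ (D : Vec Bool m) → card D ≢ 0 → ∑ (λ v → 𝟙 (lookup D v ∧ (above D v ≡ᵇ 0))) ≡ 1
∑-top []      nz = contradiction refl nz
∑-top (b ∷ D) nz = trans (cong₂ _+_ head-value tail-value) (by-cases b nz)
  where
  head-value : 𝟙 (b ∧ (above (b ∷ D) zero ≡ᵇ 0)) ≡ 𝟙 (b ∧ (card D ≡ᵇ 0))
  head-value rewrite ∧-zeroʳ b = cong (λ a → 𝟙 (b ∧ (a ≡ᵇ 0)))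
    (Fin∑.sum-cong-≗ λ u → cong 𝟙 (∧-identityʳ (lookup D u)))
  tail-value : ∑ (λ v → 𝟙 (lookup D v ∧ (above (b ∷ D) (suc v) ≡ᵇ 0)))
             ≡ ∑ (λ v → 𝟙 (lookup D v ∧ (above D v ≡ᵇ 0)))
  tail-value = Fin∑.sum-cong-≗ λ v →
    cong (λ a → 𝟙 (lookup D v ∧ (𝟙 a + above D v ≡ᵇ 0))) (∧-zeroʳ b)
  by-cases : ∀ b → 𝟙 b + card D ≢ 0 →
    𝟙 (b ∧ (card D ≡ᵇ 0)) + ∑ (λ v → 𝟙 (lookup D v ∧ (above D v ≡ᵇ 0))) ≡ 1
  by-cases b nz with card D ≟ 0
  by-cases true  nz | yes eq rewrite eq = cong suc (∑-zero⁺ _ λ v →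
    cong (λ a → 𝟙 (a ∧ (above D v ≡ᵇ 0))) (𝟙-zero _ (∑-zero⁻ (𝟙 ∘ lookup D) eq v)))
  by-cases false nz | yes eq = contradiction eq nz
  by-cases b     nz | no neq with card D in eq
  ... | zero    = contradiction refl neq
  ... | suc _   = trans (cong (λ a → 𝟙 a + _) (∧-zeroʳ b))
    (∑-top D λ z → contradiction (trans (sym eq) z) λ ())

-- Trees with a given maximal decreasing subtree, described parent by parent

colour : Vec Bool m → Fin m → Colour
colour D v = if lookup D v then front else rest

-- The label conditions for MD(T) = `D`: inside `D` labels grow towards the root, and a child of an
-- element of `D` stays outside only if its label is larger. Cycles outside `D` are not excluded
-- here; that is left to `reach`.
allowed : Vec Bool m → Fin m → Maybe (Fin m) → Bool
allowed D v nothing  = lookup D v ∧ (above D v ≡ᵇ 0)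
allowed D v (just u) =
  if lookup D v then lookup D u ∧ (toℕ v <ᵇ toℕ u) else not (lookup D u) ∨ (toℕ u <ᵇ toℕ v)

module _ {n : ℕ} (p : ParentMap n) where

  inMD-suc : ∀ f v → inMD p (suc f) v ≡ maybe (λ u → (toℕ v <ᵇ toℕ u) ∧ inMD p f u) true (lookup p v)
  inMD-suc f v with lookup p v
  ... | nothing = refl
  ... | just _  = refl

  isRoot⁺ : ∀ v → lookup p v ≡ nothing → isRoot p v ≡ true
  isRoot⁺ v eq rewrite eq = refl

  reachesRoot-mono : ∀ f v → reachesRoot p f v ≡ true → reachesRoot p (suc f) v ≡ true
  reachesRoot-mono (suc f) v eq with lookup p v
  ... | nothing = refl
  ... | just u  = reachesRoot-mono f u eq

  reachesRoot-mono-+ : ∀ g f v → reachesRoot p f v ≡ true → reachesRoot p (g + f) v ≡ true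
  reachesRoot-mono-+ zero    f v eq = eq
  reachesRoot-mono-+ (suc g) f v eq = reachesRoot-mono (g + f) v (reachesRoot-mono-+ g f v eq)

  Stable : ℕ → Set
  Stable f = ∀ v → reachesRoot p (suc f) v ≡ reachesRoot p f v

  stable-suc : ∀ f → Stable f → Stable (suc f)
  stable-suc f st v with lookup p v
  ... | nothing = refl
  ... | just u  = st u

  stable-+ : ∀ g f → Stable f → ∀ v → reachesRoot p (g + f) v ≡ reachesRoot p f v
  stable-+ zero    f st v = refl
  stable-+ (suc g) f st v = trans (stable g v) (stable-+ g f st v)
    where
    stable : ∀ g → Stable (g + f)
    stable zero    = st
    stable (suc g) = stable-suc (g + f) (stable g)

  -- The set of vertices reaching the root within f steps grows strictly until it is stable, which turns
  -- paths of any length into paths within the fuel of isRootedTree.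
  saturation : ∀ f → Stable f ⊎ f ≤ ∑ (𝟙 ∘ reachesRoot p f)
  saturation zero    = inj₂ z≤n
  saturation (suc f) with saturation f
  ... | inj₁ st = inj₁ (stable-suc f st)
  ... | inj₂ le with ∑-𝟙-compare (reachesRoot p f) (reachesRoot p (suc f)) (reachesRoot-mono f)
  ...   | inj₁ st = inj₁ (stable-suc f st)
  ...   | inj₂ lt = inj₂ (≤-trans (s≤s le) lt)

  reachesRoot-bound : ∀ f v → reachesRoot p f v ≡ true → reachesRoot p (suc n) v ≡ true
  reachesRoot-bound f v eq with saturation (suc n)
  ... | inj₂ full = ∑-𝟙-full (reachesRoot p (suc n)) full v
  ... | inj₁ st   = trans (sym (stable-+ f (suc n) st v))
    (subst (λ g → reachesRoot p g v ≡ true) (+-comm (suc n) f) (reachesRoot-mono-+ (suc n) f v eq))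

  -- Labels increase along a path of MD towards the root, so suc n ∸ toℕ v is enough fuel at v.
  inMD-fuel : ∀ f g v → inMD p f v ≡ true → suc n ≤ g + toℕ v → inMD p g v ≡ true
  inMD-fuel (suc f) zero    v eq le = contradiction (toℕ<n v) (≤⇒≯ le)
  inMD-fuel (suc f) (suc g) v eq le with lookup p v
  ... | nothing = refl
  ... | just u  with ∧-true⁻ (toℕ v <ᵇ toℕ u) eq
  ...   | v<u , eq′ = ∧-true⁺ v<u (inMD-fuel f g u eq′ (≤-trans le
                        (≤-trans (≤-reflexive (sym (+-suc g (toℕ v)))) (+-monoʳ-≤ g (<ᵇ≡true⇒< _ _ v<u)))))

  inMD-root-above : ∀ f v → inMD p f v ≡ true → ∃ λ w → isRoot p w ≡ true × toℕ v ≤ toℕ w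
  inMD-root-above (suc f) v eq with lookup p v in pv
  ... | nothing = v , isRoot⁺ v pv , ≤-refl
  ... | just u  with ∧-true⁻ (toℕ v <ᵇ toℕ u) eq
  ...   | v<u , eq′ with inMD-root-above f u eq′
  ...     | w , rw , u≤w = w , rw , ≤-trans (<⇒≤ (<ᵇ≡true⇒< _ _ v<u)) u≤w

  inMD⇒reachesRoot : ∀ f v → inMD p f v ≡ true → reachesRoot p f v ≡ true
  inMD⇒reachesRoot (suc f) v eq with lookup p v
  ... | nothing = refl
  ... | just u  = inMD⇒reachesRoot f u (proj₂ (∧-true⁻ (toℕ v <ᵇ toℕ u) eq))

  MD : Vec Bool (suc n)
  MD = Vec.tabulate (inMD p (suc n))

  MD-root : ∀ v → lookup p v ≡ nothing → lookup MD v ≡ true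
  MD-root v pv = trans (lookup∘tabulate (inMD p (suc n)) v) (trans (inMD-suc n v) (cong (maybe _ true) pv))

  MD-child : ∀ v u → lookup p v ≡ just u → lookup MD v ≡ (toℕ v <ᵇ toℕ u) ∧ lookup MD u
  MD-child v u pv = begin
    lookup MD v                          ≡⟨ lookup∘tabulate (inMD p (suc n)) v ⟩
    inMD p (suc n) v                     ≡⟨ trans (inMD-suc n v) (cong (maybe _ true) pv) ⟩
    (toℕ v <ᵇ toℕ u) ∧ inMD p n u        ≡⟨ refuel ⟩
    (toℕ v <ᵇ toℕ u) ∧ inMD p (suc n) u  ≡⟨ cong (_ ∧_) (lookup∘tabulate (inMD p (suc n)) u) ⟨
    (toℕ v <ᵇ toℕ u) ∧ lookup MD u       ∎
    where
    open ≡-Reasoning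
    refuel : (toℕ v <ᵇ toℕ u) ∧ inMD p n u ≡ (toℕ v <ᵇ toℕ u) ∧ inMD p (suc n) u
    refuel with toℕ v <ᵇ toℕ u in v<u
    ... | false = refl
    ... | true  = true-⇔
      (λ eq → inMD-fuel n (suc n) u eq (m≤m+n (suc n) (toℕ u)))
      -- Here v < u makes `toℕ u` positive, which pays for the missing unit of fuel.
      (λ eq → inMD-fuel (suc n) n u eq (≤-trans (≤-reflexive (+-comm 1 n))
                (+-monoʳ-≤ n (≤-trans (s≤s z≤n) (<ᵇ≡true⇒< (toℕ v) _ v<u)))))

  Valid : Vec Bool (suc n) → Set
  Valid D = (∀ v → allowed D v (lookup p v) ≡ true)
          × (∀ v → lookup D v ≡ false → reach (colour D) p (suc n) v ≡ true)

  isTree⇒valid : ∑ (𝟙 ∘ isRoot p) ≡ 1 → (∀ v → reachesRoot p (suc n) v ≡ true) → Valid MD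
  isTree⇒valid one-root reaches = allowed-all , λ v → reaches-MD (suc n) v (reaches v)
    where
    -- From u the path in MD climbs to a root w with u ≤ w. There is only one root, so w = v and u
    -- cannot exceed v.
    no-above : ∀ v → lookup p v ≡ nothing → ∀ u → lookup MD u ∧ (toℕ v <ᵇ toℕ u) ≡ false
    no-above v pv u with lookup MD u in Du | toℕ v <ᵇ toℕ u in v<u
    ... | false | _     = refl
    ... | true  | false = refl
    ... | true  | true  with inMD-root-above (suc n) u (trans (sym (lookup∘tabulate (inMD p (suc n)) u)) Du)
    ...   | w , rw , u≤w with ∑-𝟙≡1-unique (isRoot p) one-root v w (isRoot⁺ v pv) rw
    ...     | refl = contradiction (<ᵇ≡true⇒< (toℕ v) (toℕ u) v<u) (≤⇒≯ u≤w)

    allowed-all : ∀ v → allowed MD v (lookup p v) ≡ true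
    allowed-all v with lookup p v in pv
    ... | nothing = ∧-true⁺ (MD-root v pv)
                      (cong (_≡ᵇ 0) (∑-zero⁺ _ (λ u → cong 𝟙 (no-above v pv u))))
    ... | just u with lookup MD v in Dv | lookup MD u in Du | MD-child v u pv
    ...   | true  | Du′   | eq = trans (∧-comm Du′ _) (sym eq)
    ...   | false | false | eq = refl
    ...   | false | true  | eq = <⇒<ᵇ≡true (≤∧≢⇒< u≤v u≢v)
      where
      v≮u : (toℕ v <ᵇ toℕ u) ≡ false
      v≮u = trans (sym (∧-identityʳ _)) (sym eq)
      u≤v : toℕ u ≤ toℕ v
      u≤v = ≮⇒≥ λ v<u → contradiction (trans (sym v≮u) (<⇒<ᵇ≡true v<u)) λ ()
      u≢v : toℕ u ≢ toℕ v
      u≢v eq′ = contradiction (trans (sym Du) (trans (cong (lookup MD) (toℕ-injective eq′)) Dv)) λ ()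

    reaches-MD : ∀ f v → reachesRoot p f v ≡ true → lookup MD v ≡ false → reach (colour MD) p f v ≡ true
    reaches-MD (suc f) v eq Dv with lookup p v in pv
    ... | nothing = contradiction (trans (sym (MD-root v pv)) Dv) λ ()
    ... | just u with lookup MD u in Du
    ...   | true  = refl
    ...   | false = reaches-MD f u eq Du

  module _ (D : Vec Bool (suc n)) (valid : Valid D) where

    private
      allowed-all = proj₁ valid
      reach-all   = proj₂ valid

    present⇒inMD : ∀ f v → lookup D v ≡ true → suc n ≤ f + toℕ v → inMD p f v ≡ true
    present⇒inMD zero    v Dv le = contradiction (toℕ<n v) (≤⇒≯ le)
    present⇒inMD (suc f) v Dv le with lookup p v | allowed-all v
    ... | nothing | _ = refl
    ... | just u  | ok rewrite Dv with ∧-true⁻ (lookup D u) ok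
    ...   | Du , v<u = ∧-true⁺ v<u (present⇒inMD f u Du (≤-trans le
                        (≤-trans (≤-reflexive (sym (+-suc f (toℕ v)))) (+-monoʳ-≤ f (<ᵇ≡true⇒< _ _ v<u)))))

    -- The path from v towards the root meets no root outside `D`. It either enters `D` at a step
    -- where the child has the larger label, or is still outside when the fuel ends.
    absent⇒¬inMD : ∀ f v → lookup D v ≡ false → inMD p f v ≡ false
    absent⇒¬inMD zero    v Dv = refl
    absent⇒¬inMD (suc f) v Dv with lookup p v | allowed-all v
    ... | nothing | ok = contradiction (trans (sym (proj₁ (∧-true⁻ (lookup D v) ok))) Dv) λ ()
    ... | just u  | ok rewrite Dv with lookup D u in Du
    ...   | false = trans (cong (_ ∧_) (absent⇒¬inMD f u Du)) (∧-zeroʳ _)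
    ...   | true  = cong (_∧ inMD p f u) (≤⇒>ᵇ≡false {toℕ u} {toℕ v} (<⇒≤ (<ᵇ≡true⇒< (toℕ u) (toℕ v) ok)))

    valid⇒≡MD : D ≡ MD
    valid⇒≡MD = trans (sym (tabulate∘lookup D)) (tabulate-cong same)
      where
      same : ∀ v → lookup D v ≡ inMD p (suc n) v
      same v with lookup D v in Dv
      ... | true  = sym (present⇒inMD (suc n) v Dv (m≤m+n (suc n) (toℕ v)))
      ... | false = sym (absent⇒¬inMD (suc n) v Dv)

    present⇒reachesRoot : ∀ v → lookup D v ≡ true → reachesRoot p (suc n) v ≡ true
    present⇒reachesRoot v Dv = inMD⇒reachesRoot (suc n) v (present⇒inMD (suc n) v Dv (m≤m+n (suc n) (toℕ v)))

    reach⇒reachesRoot : ∀ f v → reach (colour D) p f v ≡ true → reachesRoot p (f + suc n) v ≡ true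
    reach⇒reachesRoot (suc f) v eq with lookup p v
    ... | just u with lookup D u in Du
    ...   | true  = reachesRoot-mono-+ f (suc n) u (present⇒reachesRoot u Du)
    ...   | false = reach⇒reachesRoot f u eq

    -- Up to n + 1 steps to `D` and n + 1 more inside it exceed the fuel of `isRootedTree`, hence
    -- the appeal to `reachesRoot-bound`.
    valid⇒reachesRoot : ∀ v → reachesRoot p (suc n) v ≡ true
    valid⇒reachesRoot v with lookup D v in Dv
    ... | true  = present⇒reachesRoot v Dv
    ... | false = reachesRoot-bound (suc n + suc n) v (reach⇒reachesRoot (suc n) v (reach-all v Dv))

    valid⇒nonempty : card D ≢ 0
    valid⇒nonempty empty = contradiction (trans (sym (reach-all zero (D-empty zero)))
      (reach-noFront (colour D) no-front p (suc n) zero)) λ ()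
      where
      D-empty : ∀ v → lookup D v ≡ false
      D-empty v = 𝟙-zero _ (∑-zero⁻ (𝟙 ∘ lookup D) empty v)
      no-front : ∀ v → isFront (colour D v) ≡ false
      no-front v = cong (λ b → isFront (if b then front else rest)) (D-empty v)

    isRoot≡top : ∀ v → isRoot p v ≡ lookup D v ∧ (above D v ≡ᵇ 0)
    isRoot≡top v with lookup p v | allowed-all v
    ... | nothing | ok = sym ok
    ... | just u  | ok with lookup D v
    ...   | false = refl
    ...   | true with above D v in eq
    ...     | suc _ = refl
    ...     | zero  = contradiction
      (trans (sym (cong 𝟙 ok)) (∑-zero⁻ (λ w → 𝟙 (lookup D w ∧ (toℕ v <ᵇ toℕ w))) eq u)) λ ()

    valid⇒one-root : ∑ (𝟙 ∘ isRoot p) ≡ 1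
    valid⇒one-root = trans (Fin∑.sum-cong-≗ (cong 𝟙 ∘ isRoot≡top)) (∑-top D valid⇒nonempty)

  isRootedTree≡ : isRootedTree p ≡ (∑ (𝟙 ∘ isRoot p) ≡ᵇ 1) ∧ allF (reachesRoot p (suc n))
  isRootedTree≡ = cong₂ (λ a b → (a ≡ᵇ 1) ∧ b)
    (trans (countB-∑L (isRoot p) (allFin (suc n))) (∑L-tabulate id (𝟙 ∘ isRoot p)))
    (all-tabulate (reachesRoot p (suc n)) id)

  mdSize≡card : mdSize p ≡ card MD
  mdSize≡card = trans (countB-∑L (inMD p (suc n)) (allFin (suc n))) (trans
    (∑L-tabulate id (𝟙 ∘ inMD p (suc n)))
    (Fin∑.sum-cong-≗ λ v → cong 𝟙 (sym (lookup∘tabulate (inMD p (suc n)) v))))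

  -- This is the shape required by `acyclic-count`: one factor per parent, times reachability. The
  -- converse works because `Valid` determines `D`.
  tree-decomposition : ∀ D → 𝟙 (isRootedTree p) * 𝟙 (does (D ≟ᵛ MD))
    ≡ ∏ (λ v → 𝟙 (allowed D v (lookup p v))) * allReach (colour D) p (suc n)
  tree-decomposition D = begin
    𝟙 (isRootedTree p) * 𝟙 (does (D ≟ᵛ MD))
      ≡⟨ 𝟙-∧ (isRootedTree p) _ ⟨
    𝟙 (isRootedTree p ∧ does (D ≟ᵛ MD))
      ≡⟨ cong 𝟙 (true-⇔ forth back) ⟩
    𝟙 (allF local ∧ allF reaching)
      ≡⟨ 𝟙-∧ (allF local) _ ⟩
    𝟙 (allF local) * 𝟙 (allF reaching)
      ≡⟨ cong₂ _*_ (∏-𝟙 local) (∏-𝟙 reaching) ⟨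
    ∏ (λ v → 𝟙 (allowed D v (lookup p v))) * allReach (colour D) p (suc n) ∎
    where
    open ≡-Reasoning
    local reaching : Fin (suc n) → Bool
    local v = allowed D v (lookup p v)
    reaching v = not (isRest (colour D v)) ∨ reach (colour D) p (suc n) v

    reaching⁺ : (∀ v → lookup D v ≡ false → reach (colour D) p (suc n) v ≡ true) → ∀ v → reaching v ≡ true
    reaching⁺ h v with lookup D v in Dv
    ... | true  = refl
    ... | false = h v Dv

    reaching⁻ : (∀ v → reaching v ≡ true) → ∀ v → lookup D v ≡ false → reach (colour D) p (suc n) v ≡ true
    reaching⁻ h v Dv = trans
      (cong (λ b → not (isRest (if b then front else rest)) ∨ reach (colour D) p (suc n) v) (sym Dv)) (h v)

    forth : isRootedTree p ∧ does (D ≟ᵛ MD) ≡ true → allF local ∧ allF reaching ≡ true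
    forth eq with D ≟ᵛ MD | ∧-true⁻ (isRootedTree p) eq
    ... | yes refl | tree , _ with ∧-true⁻ (∑ (𝟙 ∘ isRoot p) ≡ᵇ 1) (trans (sym isRootedTree≡) tree)
    ...   | one-root , reaches with isTree⇒valid (≡ᵇ≡true⇒≡ _ 1 one-root) (allF⁻ _ reaches)
    ...     | ok , rs = ∧-true⁺ (allF⁺ ok) (allF⁺ (reaching⁺ rs))
    forth eq | no _ | _ , ()

    back : allF local ∧ allF reaching ≡ true → isRootedTree p ∧ does (D ≟ᵛ MD) ≡ true
    back eq = ∧-true⁺
      (trans isRootedTree≡ (∧-true⁺
        (cong (_≡ᵇ 1) (valid⇒one-root D valid)) (allF⁺ (valid⇒reachesRoot D valid))))
      (dec-true (D ≟ᵛ MD) (valid⇒≡MD D valid))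
      where
      valid : Valid D
      valid = allF⁻ local (proj₁ (∧-true⁻ (allF local) eq))
            , reaching⁻ (allF⁻ reaching (proj₂ (∧-true⁻ (allF local) eq)))

-- Counting trees by their maximal decreasing subtree

∑-𝟙-not : ∀ (b : Fin n → Bool) → ∑ (𝟙 ∘ not ∘ b) ≡ n ∸ ∑ (𝟙 ∘ b)
∑-𝟙-not {n} b = sym (trans (cong (_∸ ∑ (𝟙 ∘ b)) (sym (total b))) (m+n∸m≡n (∑ (𝟙 ∘ b)) _))
  where
  total : ∀ {n} (b : Fin n → Bool) → ∑ (𝟙 ∘ b) + ∑ (𝟙 ∘ not ∘ b) ≡ n
  total {zero}  b = refl
  total {suc n} b with b zero
  ... | true  = cong suc (total (b ∘ suc))
  ... | false = trans (+-suc _ _) (cong suc (total (b ∘ suc)))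

absent?≡isRest : ∀ (D : Vec Bool m) v → absent? D v ≡ 𝟙 (isRest (colour D v))
absent?≡isRest D v with lookup D v
... | true  = refl
... | false = refl

#rest-colour : ∀ (D : Vec Bool m) → #rest (colour D) ≡ m ∸ card D
#rest-colour D = trans (sym (Fin∑.sum-cong-≗ (absent?≡isRest D))) (∑-𝟙-not (lookup D))

-- A vertex outside `D` counts itself among the m - |D| parents outside; such loops are removed by
-- `allReach`.
∑-allowed : ∀ (D : Vec Bool m) v → ∑L parents (𝟙 ∘ allowed D v) ≡ choices (m ∸ card D) 0 D v
∑-allowed {m = m} D v = trans (∑L-parents (𝟙 ∘ allowed D v)) (by-cases v)
  where
  by-cases : ∀ v → 𝟙 (allowed D v nothing) + ∑ (𝟙 ∘ allowed D v ∘ just) ≡ choices (m ∸ card D) 0 D v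
  by-cases v with lookup D v
  ... | true  = refl
  ... | false = trans (Fin∑.sum-cong-≗ same) (trans
    (Fin∑.∑-distrib-+ (𝟙 ∘ isRest ∘ colour D) (λ u → 𝟙 (lookup D u ∧ (toℕ u <ᵇ toℕ v))))
    (cong (_+ below D v) (#rest-colour D)))
    where
    same : ∀ u → 𝟙 (not (lookup D u) ∨ (toℕ u <ᵇ toℕ v))
               ≡ 𝟙 (isRest (colour D u)) + 𝟙 (lookup D u ∧ (toℕ u <ᵇ toℕ v))
    same u with lookup D u
    ... | true  = refl
    ... | false = refl

treesOver : Vec Bool m → ℕ
treesOver {m} D =
  ∑L (allVecs parents m) (λ p → ∏ (λ v → 𝟙 (allowed D v (lookup p v))) * allReach (colour D) p m)

treesOver-count : ∀ (D : Vec Bool m) →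
  treesOver D + ∂∏ (choices (m ∸ card D) 0 D) (absent? D) ≡ ∏ (choices (m ∸ card D) 0 D)
treesOver-count {m = m} D = begin
  treesOver D + ∂∏ (choices (m ∸ card D) 0 D) (absent? D)
    ≡⟨ cong (treesOver D +_) (∂∏-cong (∑-allowed D) (sym ∘ absent?≡isRest D)) ⟨
  treesOver D + ∂∏ (λ v → ∑L parents (𝟙 ∘ allowed D v)) (𝟙 ∘ isRest ∘ colour D)
    ≡⟨ acyclic-count m (colour D) φ (λ v → 𝟙 ∘ allowed D v) φ⊂front rest-split (∑-𝟙≤n (isRest ∘ colour D)) ⟩
  ∏ (λ v → ∑L parents (𝟙 ∘ allowed D v))
    ≡⟨ Fin∏.sum-cong-≗ (∑-allowed D) ⟩
  ∏ (choices (m ∸ card D) 0 D) ∎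
  where
  open ≡-Reasoning
  -- The condition u < v concerns only edges entering `D` from outside, hence only the first layer.
  φ : Fin m → Parent → ℕ
  φ v = maybe (λ u → 𝟙 (lookup D u ∧ (toℕ u <ᵇ toℕ v))) 0
  φ⊂front : ∀ v x → φ v x ≢ 0 → inFront (colour D) x ≡ true
  φ⊂front v nothing  nz = contradiction refl nz
  φ⊂front v (just u) nz with lookup D u
  ... | true  = refl
  ... | false = contradiction refl nz
  rest-split : ∀ v → colour D v ≡ rest → ∀ x → 𝟙 (allowed D v x) ≡ φ v x + 𝟙 (inRest (colour D) x)
  rest-split v cv nothing with lookup D v
  ... | false = refl
  rest-split v cv (just u) with lookup D v | lookup D u
  ... | false | true  = sym (+-identityʳ _)
  ... | false | false = refl

cardT-by-MD : ∀ n k → cardT n k ≡ ∑L (allVecs bools (suc n)) (λ D → 𝟙 (card D ≡ᵇ suc k) * treesOver D)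
cardT-by-MD n k = begin
  cardT n k
    ≡⟨ countB-∑L (λ p → mdSize p ≡ᵇ suc k) (trees n) ⟩
  ∑L (trees n) (λ p → 𝟙 (mdSize p ≡ᵇ suc k))
    ≡⟨ ∑L-filter isRootedTree _ ps ⟩
  ∑L ps (λ p → 𝟙 (isRootedTree p) * 𝟙 (mdSize p ≡ᵇ suc k))
    ≡⟨ ∑L-cong ps (λ p → trans
         (cong (𝟙 (isRootedTree p) *_) (by-subset p)) (sym (∑L-*ˡ Ds (𝟙 (isRootedTree p)) _))) ⟩
  ∑L ps (λ p → ∑L Ds (λ D → 𝟙 (isRootedTree p) * (𝟙 (does (D ≟ᵛ MD p)) * 𝟙 (card D ≡ᵇ suc k))))
    ≡⟨ ∑L-cong ps (λ p → ∑L-cong Ds (λ D → trans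
         (rotate (𝟙 (isRootedTree p)) (𝟙 (does (D ≟ᵛ MD p))) (𝟙 (card D ≡ᵇ suc k)))
         (cong (𝟙 (card D ≡ᵇ suc k) *_) (tree-decomposition p D)))) ⟩
  ∑L ps (λ p → ∑L Ds (λ D → 𝟙 (card D ≡ᵇ suc k) * summand p D))
    ≡⟨ ∑L-comm ps Ds _ ⟩
  ∑L Ds (λ D → ∑L ps (λ p → 𝟙 (card D ≡ᵇ suc k) * summand p D))
    ≡⟨ ∑L-cong Ds (λ D → ∑L-*ˡ ps (𝟙 (card D ≡ᵇ suc k)) (λ p → summand p D)) ⟩
  ∑L Ds (λ D → 𝟙 (card D ≡ᵇ suc k) * treesOver D) ∎
  where
  open ≡-Reasoning
  ps = allVecs (parents {suc n}) (suc n)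
  Ds = allVecs bools (suc n)
  summand : ParentMap n → Vec Bool (suc n) → ℕ
  summand p D = ∏ (λ v → 𝟙 (allowed D v (lookup p v))) * allReach (colour D) p (suc n)
  rotate : ∀ a b c → a * (b * c) ≡ c * (a * b)
  rotate = solve-∀
  by-subset : ∀ p → 𝟙 (mdSize p ≡ᵇ suc k) ≡ ∑L Ds (λ D → 𝟙 (does (D ≟ᵛ MD p)) * 𝟙 (card D ≡ᵇ suc k))
  by-subset p = trans (cong (λ a → 𝟙 (a ≡ᵇ suc k)) (mdSize≡card p))
    (sym (∑-bools-δ (MD p) (λ D → 𝟙 (card D ≡ᵇ suc k))))

-- The subtracted term has the coefficient n + 1, the number of insertion positions. As r + (k + 1)
-- = n + 1, it is exactly the part of `W-last` containing the greatest variable, and it cancels.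
cardT-formula : ∀ n k r → r + k ≡ n → cardT n k ≡ k ! * W r n k 0
cardT-formula n k r r+k≡n = +-cancelʳ-≡ (k ! * (suc n * W r n (suc k) 0)) _ _ (begin
  cardT n k + k ! * (suc n * W r n (suc k) 0)
    ≡⟨ cong₂ _+_ (cardT-by-MD n k) (sym (∑-∂∏-choices r (suc n) (suc k) 0)) ⟩
  ∑L Ds (λ D → 𝟙 (card D ≡ᵇ suc k) * treesOver D)
  + ∑L Ds (λ D → 𝟙 (card D ≡ᵇ suc k) * ∂∏ (choices r 0 D) (absent? D))
    ≡⟨ ∑L-+ Ds _ _ ⟨
  ∑L Ds (λ D → 𝟙 (card D ≡ᵇ suc k) * treesOver D + 𝟙 (card D ≡ᵇ suc k) * ∂∏ (choices r 0 D) (absent? D))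
    ≡⟨ ∑L-cong Ds per-subset ⟩
  ∑L Ds (λ D → 𝟙 (card D ≡ᵇ suc k) * ∏ (choices r 0 D))
    ≡⟨ ∑-∏-choices r (suc n) (suc k) 0 ⟩
  k ! * W r (suc n) (suc k) 0
    ≡⟨ cong (k ! *_) (W-last r n k 0) ⟩
  k ! * (W r n k 0 + (r + suc k) * W r n (suc k) 0)
    ≡⟨ cong (λ a → k ! * (W r n k 0 + a * W r n (suc k) 0)) (trans (+-suc r k) (cong suc r+k≡n)) ⟩
  k ! * (W r n k 0 + suc n * W r n (suc k) 0)
    ≡⟨ *-distribˡ-+ (k !) _ _ ⟩
  k ! * W r n k 0 + k ! * (suc n * W r n (suc k) 0) ∎)
  where
  open ≡-Reasoning
  Ds = allVecs bools (suc n)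
  suc-n∸ : suc n ∸ suc k ≡ r
  suc-n∸ = trans (cong (_∸ k) (sym r+k≡n)) (m+n∸n≡m r k)
  per-subset : ∀ D → 𝟙 (card D ≡ᵇ suc k) * treesOver D + 𝟙 (card D ≡ᵇ suc k) * ∂∏ (choices r 0 D) (absent? D)
                   ≡ 𝟙 (card D ≡ᵇ suc k) * ∏ (choices r 0 D)
  per-subset D with card D ≡ᵇ suc k in eq
  ... | false = refl
  ... | true  = trans
    (cong₂ _+_ (+-identityʳ (treesOver D)) (+-identityʳ (∂∏ (choices r 0 D) (absent? D)))) (trans
    (subst (λ s → treesOver D + ∂∏ (choices s 0 D) (absent? D) ≡ ∏ (choices s 0 D))
           (trans (cong (suc n ∸_) (≡ᵇ≡true⇒≡ (card D) (suc k) eq)) suc-n∸)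
           (treesOver-count D))
    (sym (+-identityʳ _)))

-- Functions hitting a given set

hit : Vec (Fin n) m → Fin n → Bool
hit f j = L.any (λ x → toℕ x ≡ᵇ toℕ j) (toList f)

covers : (Fin n → Bool) → Vec (Fin n) m → Bool
covers K f = allF (λ j → not (K j) ∨ hit f j)

infixl 6 _∖_
_∖_ : (Fin n → Bool) → Fin n → Fin n → Bool
(K ∖ x) j = K j ∧ not (toℕ x ≡ᵇ toℕ j)

covers-∷ : ∀ (K : Fin n → Bool) x (f : Vec (Fin n) m) → covers K (x ∷ f) ≡ covers (K ∖ x) f
covers-∷ K x f = allF-cong same
  where
  same : ∀ j → not (K j) ∨ ((toℕ x ≡ᵇ toℕ j) ∨ hit f j) ≡ not (K j ∧ not (toℕ x ≡ᵇ toℕ j)) ∨ hit f j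
  same j with K j | toℕ x ≡ᵇ toℕ j
  ... | false | _     = refl
  ... | true  | false = refl
  ... | true  | true  = refl

∑-∖ : ∀ (K : Fin n → Bool) x → 𝟙 (K x) + ∑ (𝟙 ∘ (K ∖ x)) ≡ ∑ (𝟙 ∘ K)
∑-∖ K zero = cong₂ (λ a b → 𝟙 (K zero) + (𝟙 a + b)) (∧-zeroʳ (K zero))
  (Fin∑.sum-cong-≗ λ j → cong 𝟙 (∧-identityʳ (K (suc j))))
∑-∖ K (suc x) = begin
  𝟙 (K (suc x)) + (𝟙 (K zero ∧ true) + s)  ≡⟨ cong (λ a → 𝟙 (K (suc x)) + (𝟙 a + s)) (∧-identityʳ (K zero)) ⟩
  𝟙 (K (suc x)) + (𝟙 (K zero) + s)         ≡⟨ swap (𝟙 (K (suc x))) (𝟙 (K zero)) s ⟩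
  𝟙 (K zero) + (𝟙 (K (suc x)) + s)         ≡⟨ cong (𝟙 (K zero) +_) (∑-∖ (K ∘ suc) x) ⟩
  ∑ (𝟙 ∘ K)                                ∎
  where
  open ≡-Reasoning
  s = ∑ (𝟙 ∘ ((K ∘ suc) ∖ x))
  swap : ∀ a b c → a + (b + c) ≡ b + (a + c)
  swap = solve-∀

-- The number of maps from an m-element set to an n-element set whose image contains a given i-element set.
covering : ℕ → ℕ → ℕ → ℕ
covering n zero    zero    = 1
covering n zero    (suc i) = 0
covering n (suc m) i       = (n ∸ i) * covering n m i + i * covering n m (pred i)

covers-[] : ∀ (K : Fin n → Bool) i → ∑ (𝟙 ∘ K) ≡ i → 𝟙 (covers K []) ≡ covering n 0 i
covers-[] K zero    eq = cong 𝟙 (allF⁺ λ j → cong (λ b → not b ∨ false) (𝟙-zero _ (∑-zero⁻ (𝟙 ∘ K) eq j)))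
covers-[] K (suc i) eq with covers K [] in all
... | false = refl
... | true  = contradiction (trans (sym eq) (∑-zero⁺ (𝟙 ∘ K) λ j → absent j (allF⁻ _ all j))) λ ()
  where
  absent : ∀ j → not (K j) ∨ false ≡ true → 𝟙 (K j) ≡ 0
  absent j eq with K j
  ... | false = refl

-- The induction removes the first value from the set still to be hit. This does not preserve
-- initial segments, so `K` is arbitrary and only its size enters.
∑-covers : ∀ n m (K : Fin n → Bool) i → ∑ (𝟙 ∘ K) ≡ i →
           ∑L (allVecs (allFin n) m) (𝟙 ∘ covers K) ≡ covering n m i
∑-covers n zero    K i eq = trans (+-identityʳ _) (covers-[] K i eq)
∑-covers n (suc m) K i eq = begin
  ∑L (allVecs (allFin n) (suc m)) (𝟙 ∘ covers K)
    ≡⟨ ∑L-allVecs (allFin n) m _ ⟩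
  ∑L (allFin n) (λ x → ∑L (allVecs (allFin n) m) (λ f → 𝟙 (covers K (x ∷ f))))
    ≡⟨ ∑L-tabulate id (λ x → ∑L (allVecs (allFin n) m) (λ f → 𝟙 (covers K (x ∷ f)))) ⟩
  ∑ (λ x → ∑L (allVecs (allFin n) m) (λ f → 𝟙 (covers K (x ∷ f))))
    ≡⟨ Fin∑.sum-cong-≗ per-value ⟩
  ∑ (λ x → 𝟙 (not (K x)) * covering n m i + 𝟙 (K x) * covering n m (pred i))
    ≡⟨ Fin∑.∑-distrib-+ (λ x → 𝟙 (not (K x)) * covering n m i) (λ x → 𝟙 (K x) * covering n m (pred i)) ⟩
  ∑ (λ x → 𝟙 (not (K x)) * covering n m i) + ∑ (λ x → 𝟙 (K x) * covering n m (pred i))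
    ≡⟨ cong₂ _+_ (sym (Fin∑.*-distribʳ-sum (covering n m i) (𝟙 ∘ not ∘ K)))
                 (sym (Fin∑.*-distribʳ-sum (covering n m (pred i)) (𝟙 ∘ K))) ⟩
  ∑ (𝟙 ∘ not ∘ K) * covering n m i + ∑ (𝟙 ∘ K) * covering n m (pred i)
    ≡⟨ cong₂ (λ a b → a * covering n m i + b * covering n m (pred i))
         (trans (∑-𝟙-not K) (cong (n ∸_) eq)) eq ⟩
  covering n (suc m) i ∎
  where
  open ≡-Reasoning
  per-value : ∀ x → ∑L (allVecs (allFin n) m) (λ f → 𝟙 (covers K (x ∷ f)))
                  ≡ 𝟙 (not (K x)) * covering n m i + 𝟙 (K x) * covering n m (pred i)
  per-value x with K x | ∑-∖ K x
  ... | false | rem = trans (∑L-cong (allVecs (allFin n) m) (λ f → cong 𝟙 (covers-∷ K x f)))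
      (trans (∑-covers n m (K ∖ x) i (trans rem eq)) (sym (trans (+-identityʳ _) (+-identityʳ _))))
  ... | true  | rem = trans (∑L-cong (allVecs (allFin n) m) (λ f → cong 𝟙 (covers-∷ K x f)))
      (trans (∑-covers n m (K ∖ x) (pred i) (cong pred (trans rem eq))) (sym (+-identityʳ _)))

∑-<ᵇ : ∀ n k → k ≤ n → ∑ {n} (λ j → 𝟙 (toℕ j <ᵇ k)) ≡ k
∑-<ᵇ n       zero    le       = ∑-zero⁺ {n} _ (λ _ → refl)
∑-<ᵇ (suc n) (suc k) (s≤s le) = cong suc (∑-<ᵇ n k le)

cardF-covering : ∀ n k → k ≤ n → cardF n k ≡ covering n n k
cardF-covering n k k≤n = trans (countB-∑L (imageContains k) (allVecs (allFin n) n)) (trans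
  (∑L-cong (allVecs (allFin n) n) λ f → cong 𝟙 (all-tabulate (λ j → not (toℕ j <ᵇ k) ∨ inImage f j) id))
  (∑-covers n n (λ j → toℕ j <ᵇ k) k (∑-<ᵇ n k k≤n)))

-- A letter is marked when it hits a required value for the first time. The numbers of candidates
-- multiply to i!, and each hit value joins the r + j freely available ones, which raises j.
covering-W : ∀ r m i j → covering (r + j + i) m i ≡ i ! * W r m i j
covering-W r zero    zero    j = refl
covering-W r zero    (suc i) j = sym (*-zeroʳ (suc i !))
covering-W r (suc m) zero    j = trans
  (cong (λ a → (r + j + 0) * a + 0) (covering-W r m 0 j)) (identity (r + j) (W r m 0 j))
  where
  identity : ∀ x w → (x + 0) * (1 * w) + 0 ≡ 1 * (x * w)
  identity = solve-∀
covering-W r (suc m) (suc i) j = trans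
  (cong₂ _+_ (cong₂ _*_ (m+n∸n≡m (r + j) (suc i)) (covering-W r m (suc i) j))
             (cong (suc i *_) (trans (cong (λ a → covering a m i) shift) (covering-W r m i (suc j)))))
  (identity (r + j) (suc i) (i !) (W r m (suc i) j) (W r m i (suc j)))
  where
  shift : r + j + suc i ≡ r + suc j + i
  shift = trans (+-suc (r + j) i) (cong (_+ i) (sym (+-suc r j)))
  identity : ∀ x s f w w′ → x * (s * f * w) + s * (f * w′) ≡ s * f * (w′ + x * w)
  identity = solve-∀

cardT≡covering : ∀ n k → k ≤ n → cardT n k ≡ covering n n k
cardT≡covering n k k≤n = trans (cardT-formula n k (n ∸ k) (m∸n+n≡m k≤n)) (trans
  (sym (covering-W (n ∸ k) n k 0))
  (cong (λ a → covering a n k) (trans (cong (_+ k) (+-identityʳ (n ∸ k))) (m∸n+n≡m k≤n))))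

covering-zero : ∀ n m → covering n m 0 ≡ n ^ m
covering-zero n zero    = refl
covering-zero n (suc m) = trans (+-identityʳ _) (cong (n *_) (covering-zero n m))

covering-small : ∀ n {m i} → m < i → covering n m i ≡ 0
covering-small n {zero}  {suc i} m<i       = refl
covering-small n {suc m} {suc i} (s≤s m<i)
  rewrite covering-small n (m≤n⇒m≤1+n m<i) | covering-small n m<i =
  cong₂ _+_ (*-zeroʳ (n ∸ suc i)) (*-zeroʳ (suc i))

-- Cleared of the denominator and of the subtraction; `suc j ≤ n` makes `n ∸ suc j` a true
-- difference.
covering-recurrence : ∀ n m j → suc j ≤ n →
  covering n (suc m) (suc j) + suc j * covering n m (suc j)
  ≡ n * covering n m (suc j) + suc j * covering n m j
covering-recurrence n m j j<n = trans
  (collect (n ∸ suc j) (suc j) (covering n m (suc j)) (covering n m j))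
  (cong (λ a → a * covering n m (suc j) + suc j * covering n m j) (m∸n+n≡m j<n))
  where
  collect : ∀ d s c c′ → d * c + s * c′ + s * c ≡ (d + s) * c + s * c′
  collect = solve-∀

-- The weighted sum

open import Data.Integer using (+_)

ι : ℕ → ℚ
ι a = + a / 1

-- Normalised fractions hide their numerators behind a gcd. In ℚᵘ the identities below become cross
-- multiplications of integers.
fromℚᵘ-+ : ∀ p q → fromℚᵘ p +ℚ fromℚᵘ q ≡ fromℚᵘ (p +ᵘ q)
fromℚᵘ-+ p q = ℚ.toℚᵘ-injective (ℚᵘ.≃-trans (ℚ.toℚᵘ-homo-+ (fromℚᵘ p) (fromℚᵘ q))
  (ℚᵘ.≃-trans (ℚᵘ.+-cong (ℚ.toℚᵘ-fromℚᵘ p) (ℚ.toℚᵘ-fromℚᵘ q)) (ℚᵘ.≃-sym (ℚ.toℚᵘ-fromℚᵘ (p +ᵘ q)))))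

fromℚᵘ-* : ∀ p q → fromℚᵘ p *ℚ fromℚᵘ q ≡ fromℚᵘ (p *ᵘ q)
fromℚᵘ-* p q = ℚ.toℚᵘ-injective (ℚᵘ.≃-trans (ℚ.toℚᵘ-homo-* (fromℚᵘ p) (fromℚᵘ q))
  (ℚᵘ.≃-trans (ℚᵘ.*-cong (ℚ.toℚᵘ-fromℚᵘ p) (ℚ.toℚᵘ-fromℚᵘ q)) (ℚᵘ.≃-sym (ℚ.toℚᵘ-fromℚᵘ (p *ᵘ q)))))

ι-+ : ∀ a b → ι a +ℚ ι b ≡ ι (a + b)
ι-+ a b = trans (fromℚᵘ-+ (mkℚᵘ (+ a) 0) (mkℚᵘ (+ b) 0))
  (ℚ.fromℚᵘ-cong {mkℚᵘ (+ a) 0 +ᵘ mkℚᵘ (+ b) 0} {mkℚᵘ (+ (a + b)) 0}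
    (*≡* (identity (+ a) (+ b))))
  where
  identity : ∀ a b → (a ℤ.* + 1 ℤ.+ b ℤ.* + 1) ℤ.* + 1 ≡ (a ℤ.+ b) ℤ.* + 1
  identity = ℤSolver.solve-∀

ι-* : ∀ a b → ι a *ℚ ι b ≡ ι (a * b)
ι-* a b = trans (fromℚᵘ-* (mkℚᵘ (+ a) 0) (mkℚᵘ (+ b) 0))
  (ℚ.fromℚᵘ-cong {mkℚᵘ (+ a) 0 *ᵘ mkℚᵘ (+ b) 0} {mkℚᵘ (+ (a * b)) 0}
    (*≡* (cong (ℤ._* + 1) (sym (ℤ.pos-* a b)))))

/-recurrence : ∀ p q r n j → p + suc j * q ≡ n * q + suc j * r →
               + p / suc j +ℚ ι q ≡ ι n *ℚ (+ q / suc j) +ℚ ι r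
/-recurrence p q r n j eq = begin
  + p / suc j +ℚ ι q
    ≡⟨ fromℚᵘ-+ P Q₁ ⟩
  fromℚᵘ (P +ᵘ Q₁)
    ≡⟨ ℚ.fromℚᵘ-cong {P +ᵘ Q₁} {N *ᵘ Q +ᵘ R} (*≡* cross) ⟩
  fromℚᵘ (N *ᵘ Q +ᵘ R)
    ≡⟨ fromℚᵘ-+ (N *ᵘ Q) R ⟨
  fromℚᵘ (N *ᵘ Q) +ℚ ι r
    ≡⟨ cong (_+ℚ ι r) (fromℚᵘ-* N Q) ⟨
  ι n *ℚ (+ q / suc j) +ℚ ι r ∎
  where
  open ≡-Reasoning
  P Q Q₁ N R : ℚᵘ
  P = mkℚᵘ (+ p) j
  Q = mkℚᵘ (+ q) j
  Q₁ = mkℚᵘ (+ q) 0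
  N = mkℚᵘ (+ n) 0
  R = mkℚᵘ (+ r) 0
  s = suc j
  numerators : + p ℤ.+ + q ℤ.* + s ≡ + n ℤ.* + q ℤ.+ + r ℤ.* + s
  numerators = begin
    + p ℤ.+ + q ℤ.* + s          ≡⟨ cong (ℤ._+_ (+ p)) (sym (ℤ.pos-* q s)) ⟩
    + (p + q * s)                ≡⟨ cong (λ a → + (p + a)) (*-comm q s) ⟩
    + (p + s * q)                ≡⟨ cong +_ eq ⟩
    + (n * q + s * r)            ≡⟨ cong (λ a → + (n * q + a)) (*-comm s r) ⟩
    + (n * q) ℤ.+ + (r * s)      ≡⟨ cong₂ ℤ._+_ (ℤ.pos-* n q) (ℤ.pos-* r s) ⟩
    + n ℤ.* + q ℤ.+ + r ℤ.* + s  ∎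
  clear : ∀ p q n r s → p ℤ.+ q ℤ.* s ≡ n ℤ.* q ℤ.+ r ℤ.* s →
          (p ℤ.* + 1 ℤ.+ q ℤ.* s) ℤ.* s ≡ ((n ℤ.* q) ℤ.* + 1 ℤ.+ r ℤ.* s) ℤ.* s
  clear p q n r s eq = cong (ℤ._* s) (trans (cong (ℤ._+ q ℤ.* s) (ℤ.*-identityʳ p))
    (trans eq (cong (ℤ._+ r ℤ.* s) (sym (ℤ.*-identityʳ (n ℤ.* q))))))
  cross : (+ p ℤ.* + 1 ℤ.+ + q ℤ.* + s) ℤ.* + (1 * s * 1)
        ≡ ((+ n ℤ.* + q) ℤ.* + 1 ℤ.+ + r ℤ.* + (1 * s)) ℤ.* + (s * 1)
  cross rewrite +-identityʳ j | *-identityʳ j = clear (+ p) (+ q) (+ n) (+ r) (+ s) numerators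

weightedSum-cong : ∀ j {c d : ℕ → ℕ} → (∀ k → k ≤ j → c k ≡ d k) → weightedSum j c ≡ weightedSum j d
weightedSum-cong zero    eq = refl
weightedSum-cong (suc j) eq = cong₂ _+ℚ_ (weightedSum-cong j (λ k k≤j → eq k (m≤n⇒m≤1+n k≤j)))
  (cong (λ a → + a / suc j) (eq (suc j) ≤-refl))

weightedSum-zero : ∀ j {c : ℕ → ℕ} → (∀ k → c (suc k) ≡ 0) → weightedSum j c ≡ 0ℚ
weightedSum-zero zero        eq = refl
weightedSum-zero (suc j) {c} eq = trans
  (cong₂ _+ℚ_ (weightedSum-zero j eq) (trans (cong (λ a → + a / suc j) (eq j))
    (ℚ.fromℚᵘ-cong {mkℚᵘ (+ 0) j} {mkℚᵘ (+ 0) 0} (*≡* refl))))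
  (ℚ.+-identityʳ 0ℚ)

-- Partial sums turn the telescoping into an induction on j; only the boundary terms at 0 and j
-- survive.
weightedSum-covering-suc : ∀ n m j → j ≤ n →
  weightedSum j (covering n (suc m)) +ℚ ι (covering n m j)
  ≡ ι n *ℚ weightedSum j (covering n m) +ℚ ι (covering n m 0)
weightedSum-covering-suc n m zero    j≤n = cong (_+ℚ ι (covering n m 0)) (sym (ℚ.*-zeroʳ (ι n)))
weightedSum-covering-suc n m (suc j) j<n = begin
  (S′ +ℚ P) +ℚ ι (c (suc j))
    ≡⟨ ℚ.+-assoc S′ P _ ⟩
  S′ +ℚ (P +ℚ ι (c (suc j)))
    ≡⟨ cong (S′ +ℚ_) (/-recurrence (covering n (suc m) (suc j)) (c (suc j)) (c j) n j
         (covering-recurrence n m j j<n)) ⟩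
  S′ +ℚ (ι n *ℚ Q +ℚ ι (c j))
    ≡⟨ cong (S′ +ℚ_) (ℚ.+-comm (ι n *ℚ Q) _) ⟩
  S′ +ℚ (ι (c j) +ℚ ι n *ℚ Q)
    ≡⟨ ℚ.+-assoc S′ _ _ ⟨
  (S′ +ℚ ι (c j)) +ℚ ι n *ℚ Q
    ≡⟨ cong (_+ℚ ι n *ℚ Q) (weightedSum-covering-suc n m j (<⇒≤ j<n)) ⟩
  (ι n *ℚ S +ℚ ι (c 0)) +ℚ ι n *ℚ Q
    ≡⟨ ℚ.+-assoc (ι n *ℚ S) _ _ ⟩
  ι n *ℚ S +ℚ (ι (c 0) +ℚ ι n *ℚ Q)
    ≡⟨ cong (ι n *ℚ S +ℚ_) (ℚ.+-comm (ι (c 0)) _) ⟩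
  ι n *ℚ S +ℚ (ι n *ℚ Q +ℚ ι (c 0))
    ≡⟨ ℚ.+-assoc (ι n *ℚ S) _ _ ⟨
  (ι n *ℚ S +ℚ ι n *ℚ Q) +ℚ ι (c 0)
    ≡⟨ cong (_+ℚ ι (c 0)) (ℚ.*-distribˡ-+ (ι n) S Q) ⟨
  ι n *ℚ (S +ℚ Q) +ℚ ι (c 0) ∎
  where
  open ≡-Reasoning
  c = covering n m
  S′ = weightedSum j (covering n (suc m))
  S = weightedSum j c
  P = + covering n (suc m) (suc j) / suc j
  Q = + c (suc j) / suc j

-- For m < n the boundary terms are c m n = 0 and c m 0 = n^m, so the sums satisfy S (m + 1) = n S m
-- + n^m with S 0 = 0. The index `suc m` avoids the exponent m - 1.
weightedSum-covering : ∀ n m → m < n → weightedSum n (covering n (suc m)) ≡ ι (suc m * n ^ m)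
weightedSum-covering n m m<n = begin
  weightedSum n (covering n (suc m))
    ≡⟨ ℚ.+-identityʳ _ ⟨
  weightedSum n (covering n (suc m)) +ℚ 0ℚ
    ≡⟨ cong (λ a → weightedSum n (covering n (suc m)) +ℚ ι a) (covering-small n m<n) ⟨
  weightedSum n (covering n (suc m)) +ℚ ι (covering n m n)
    ≡⟨ weightedSum-covering-suc n m n ≤-refl ⟩
  ι n *ℚ weightedSum n (covering n m) +ℚ ι (covering n m 0)
    ≡⟨ cong₂ _+ℚ_ (previous m m<n) (cong ι (covering-zero n m)) ⟩
  ι (m * n ^ m) +ℚ ι (n ^ m)
    ≡⟨ ι-+ (m * n ^ m) (n ^ m) ⟩
  ι (m * n ^ m + n ^ m)
    ≡⟨ cong ι (+-comm (m * n ^ m) (n ^ m)) ⟩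
  ι (suc m * n ^ m) ∎
  where
  open ≡-Reasoning
  swap : ∀ n s t → n * (s * t) ≡ s * (n * t)
  swap = solve-∀
  previous : ∀ m → m < n → ι n *ℚ weightedSum n (covering n m) ≡ ι (m * n ^ m)
  previous zero    m<n = trans (cong (ι n *ℚ_) (weightedSum-zero n (λ _ → refl))) (ℚ.*-zeroʳ (ι n))
  previous (suc m) m<n = trans (cong (ι n *ℚ_) (weightedSum-covering n m (<⇒≤ m<n))) (trans
    (ι-* n (suc m * n ^ m)) (cong ι (swap n (suc m) (n ^ m))))

theorem3p4 : (n : ℕ) → 1 ≤ n →
    (weightedSum n (cardT n) ≡ weightedSum n (cardF n)) ×
    (weightedSum n (cardF n) ≡ (+ (n ^ n)) / 1)
theorem3p4 n@(suc n-1) _ =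
    weightedSum-cong n (λ k k≤n → trans (cardT≡covering n k k≤n) (sym (cardF-covering n k k≤n)))
  -- At m = n - 1 the value `suc m * n ^ m` is `n ^ n` by computation.
  , trans (weightedSum-cong n (cardF-covering n)) (weightedSum-covering n n-1 ≤-refl)
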